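{- Let $r,s,t\ge 1$ and $D\ge 3$. Let $\mathcal G=\{G_1,\dots,G_t\}$ be an $s$-joined graph family on $n$ vertices. Let $H_0$ be a rooted forest with $r$ components, each having a single root, the roots being $h_1,\dots,h_r$. Let $H$ be an $H_0$-path-constructible graph, by paths of length at least $2\lceil\log s/\log(D-1)\rceil+3$, with $|V(H)|\le n-6sD$. Then for each $[t]$-edge coloring $\mathcal H$ of $H$ with $\Delta^{mon}(\mathcal H)\le D$ there exist sets $W\subseteq V'\subseteq V(\mathcal G)$ with $|V'|\ge n-s$ and $|W|\ge n-3sD-5s$ such that for any distinct $v_1,\dots,v_r\in W$ there exist a rooted structure on $\mathcal H$ whose roots include $h_1,\dots,h_r$ and a $(2s,D)$-good embedding $\phi:\mathcal H\hookrightarrow\mathcal G[V']$ with $\phi(h_i)=v_i$ for each $i\in[r]$.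
   Context: $\mathcal G=\{G_1,\dots,G_t\}$ is a family of graphs on a common vertex set $V$, $|V|=n$; $\mathcal G[V']=\{G_1[V'],\dots,G_t[V']\}$. $\mathcal G$ is $s$-joined if for all $X\subseteq V\times[t]$, $Y\subseteq V$ with $|X|,|Y|\ge s$ there exist $(u,i)\in X$, $v\in Y$ with $uv\in E(G_i)$. A $[t]$-edge coloring colors edges from $[t]$; $H_i$ is the subgraph of color-$i$ edges; $\Delta^{mon}(\mathcal H)=\max_i\Delta(H_i)$. An embedding $\phi:\mathcal H\hookrightarrow\mathcal G$ is an injective map $V(\mathcal H)\to V$ with $\phi(u)\phi(v)\in E(G_i)$ for each edge $uv$ of color $i$. For $X\subseteq V\times[t]$, $\Gamma_{\mathcal G}(X)=\bigcup_{(v,i)\in X}\Gamma_{G_i}(v)$. A rooted graph has a distinguished root set such that each non-root vertex $h$ has a unique path to the root set meeting it only at its end; the neighbour of $h$ on it is its parent. For an embedding $\phi$ of rooted $\mathcal H$ and $X\subseteq V\times[t]$, $R(X,\phi)=|\Gamma_{\mathcal G}(X)\setminus\phi(V(\mathcal H))|-\sum_{(v,i)\in X}[D-\deg_{H_i}(\phi^{ -1}(v))]-|P_\phi(\mathcal H)\cap X|$, with $\deg_{H_i}(\phi^{ -1}(v))=0$ for $v\notin\phi(V(\mathcal H))$, and $P_\phi(\mathcal H)$ the set of pairs $(\phi(h),i)$ with $h$ non-root and $i$ the color of the edge from $h$ to its parent. $\phi$ is $(s',D)$-good if $R(X,\phi)\ge0$ for all $X\subseteq V\times[t]$ with $|X|\le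 s'$ (here the ambient family is $\mathcal G[V']$, with $V'$ in place of $V$). $H$ is $H_0$-path-constructible if there are edge-disjoint paths $P_1,\dots,P_k$ with $E(H)=E(H_0)\cup\bigcup_jE(P_j)$, the internal vertices of each $P_i$ disjoint from $V(H_0)\cup\bigcup_{j<i}V(P_j)$, and at least one endpoint of $P_i$ in $V(H_0)\cup\bigcup_{j<i}V(P_j)$. -}

module Defs where

open import Data.Bool using (Bool; true; false; _∧_; _∨_; not; if_then_else_)
open import Data.Nat using (ℕ; zero; suc; _+_; _*_; _∸_; _^_; _≤_; _<_)
open import Data.Fin using (Fin) renaming (zero to fzero; suc to fsuc)
import Data.Fin as F
open import Data.List using (List; []; _∷_; _++_; [_]; length)
open import Data.List.Relation.Unary.All using (All)
open import Data.List.Relation.Unary.Linked using (Linked)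
open import Data.List.Relation.Unary.Unique.Propositional using (Unique)
open import Data.List.Membership.Propositional using (_∈_; _∉_)
open import Data.Product using (Σ; _×_; _,_; ∃; ∃₂)
open import Data.Sum using (_⊎_)
open import Data.Empty using (⊥)
open import Function using (_∘_)
open import Function.Definitions using (Injective)
open import Relation.Binary.PropositionalEquality using (_≡_; _≢_)
open import Relation.Binary.Construct.Closure.ReflexiveTransitive using (Star)
open import Relation.Nullary.Decidable using (⌊_⌋)

sumF : ∀ {k} → (Fin k → ℕ) → ℕ
sumF {zero}  f = 0
sumF {suc k} f = f fzero + sumF (f ∘ fsuc)

count : ∀ {k} → (Fin k → Bool) → ℕ
count p = sumF (λ x → if p x then 1 else 0)

anyF : ∀ {k} → (Fin k → Bool) → Bool
anyF {zero}  p = false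
anyF {suc k} p = p fzero ∨ anyF (p ∘ fsuc)

_==_ : ∀ {k} → Fin k → Fin k → Bool
a == b = ⌊ a F.≟ b ⌋

Graph : ℕ → Set
Graph k = Fin k → Fin k → Bool

IsSimple : ∀ {k} → Graph k → Set
IsSimple {k} A = (∀ u v → A u v ≡ A v u) × (∀ u → A u u ≡ false)

Adj : ∀ {k} → Graph k → Fin k → Fin k → Set
Adj A u v = A u v ≡ true

Family : ℕ → ℕ → Set
Family n t = Fin t → Graph n

Sub2 : ℕ → ℕ → Set
Sub2 n t = Fin n → Fin t → Bool

card2 : ∀ {n t} → Sub2 n t → ℕ
card2 X = sumF (λ v → count (X v))

SJoined : ∀ {n t} → ℕ → Family n t → Set
SJoined {n} {t} s G =
  (X : Sub2 n t) (Y : Fin n → Bool) → s ≤ card2 X → s ≤ count Y →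
  Σ (Fin n) λ u → Σ (Fin t) λ i → Σ (Fin n) λ v →
    (X u i ≡ true) × (Y v ≡ true) × Adj (G i) u v

-- ⌈log s / log b⌉ for s ≥ 1, b ≥ 2: the least k ∈ ℕ with s ≤ b^k

IsCeilLog : ℕ → ℕ → ℕ → Set
IsCeilLog b s k = (s ≤ b ^ k) × (∀ j → s ≤ b ^ j → k ≤ j)

IsCycle : ∀ {k} → Graph k → List (Fin k) → Set
IsCycle A [] = ⊥
IsCycle A (x ∷ xs) =
  (3 ≤ length (x ∷ xs)) × Unique (x ∷ xs) × Linked (Adj A) ((x ∷ xs) ++ [ x ])

EdgeIn : ∀ {k} → List (Fin k) → Fin k → Fin k → Set
EdgeIn p u v =
  (∃₂ λ xs ys → p ≡ xs ++ u ∷ v ∷ ys) ⊎ (∃₂ λ xs ys → p ≡ xs ++ v ∷ u ∷ ys)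

Internal : ∀ {k} → List (Fin k) → Fin k → Set
Internal {k} p x =
  Σ (Fin k) λ a → Σ (Fin k) λ b → ∃₂ λ xs ys → p ≡ a ∷ xs ++ x ∷ ys ++ [ b ]

Endpoint : ∀ {k} → List (Fin k) → Fin k → Set
Endpoint p x = (∃ λ xs → p ≡ x ∷ xs) ⊎ (∃ λ xs → p ≡ xs ++ [ x ])

record RootedForest {m r : ℕ} (V0 : Fin m → Bool) (E0 : Graph m)
                    (h : Fin r → Fin m) : Set where
  field
    simple    : IsSimple E0
    edgesIn   : ∀ u v → Adj E0 u v → (V0 u ≡ true) × (V0 v ≡ true)
    acyclic   : ∀ c → IsCycle E0 c → ⊥
    rootsIn   : ∀ i → V0 (h i) ≡ true
    rootsSep  : ∀ i j → Star (Adj E0) (h i) (h j) → i ≡ j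
    covered   : ∀ u → V0 u ≡ true → Σ (Fin r) λ i → Star (Adj E0) (h i) u

-- H (on Fin m) is H0-path-constructible by paths P 0..P (k-1)
-- (in this order) each of length (number of edges) at least L.

_<ᶠ_ : ∀ {k} → Fin k → Fin k → Set
a <ᶠ b = F.toℕ a < F.toℕ b

record PathConstructible {m : ℕ} (H : Graph m) (V0 : Fin m → Bool)
                         (E0 : Graph m) (L : ℕ) : Set where
  field
    k        : ℕ
    P        : Fin k → List (Fin m)
    isPath   : ∀ j → Unique (P j)
    long     : ∀ j → L + 1 ≤ length (P j)
    edges    : ∀ u v → (Adj H u v → (Adj E0 u v ⊎ Σ (Fin k) λ j → EdgeIn (P j) u v))
                     × ((Adj E0 u v ⊎ Σ (Fin k) λ j → EdgeIn (P j) u v) → Adj H u v)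
    vertices : ∀ x → (V0 x ≡ true) ⊎ (Σ (Fin k) λ j → x ∈ P j)
    edgeDisj : ∀ j j' u v → j ≢ j' → EdgeIn (P j) u v → EdgeIn (P j') u v →
               ⊥
    internal : ∀ j x → Internal (P j) x →
               (V0 x ≡ false) × (∀ j' → j' <ᶠ j → x ∉ P j')
    anchored : ∀ j → Σ (Fin m) λ x → Endpoint (P j) x ×
               ((V0 x ≡ true) ⊎ (Σ (Fin k) λ j' → j' <ᶠ j × x ∈ P j'))

-- col u v is the colour of the edge uv (meaningful only when uv ∈ E(H))
IsColouring : ∀ {m t} → Graph m → (Fin m → Fin m → Fin t) → Set
IsColouring H col = ∀ u v → Adj H u v → col u v ≡ col v u

degC : ∀ {m t} → Graph m → (Fin m → Fin m → Fin t) → Fin t → Fin m → ℕ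
degC H col i x = count (λ y → H x y ∧ (col x y == i))

MonDegLe : ∀ {m t} → Graph m → (Fin m → Fin m → Fin t) → ℕ → Set
MonDegLe H col D = ∀ i x → degC H col i x ≤ D

firstOr : ∀ {k} → List (Fin k) → Fin k → Fin k
firstOr []       z = z
firstOr (y ∷ ys) z = y

IsRootPath : ∀ {m} → Graph m → (Fin m → Bool) → Fin m → List (Fin m) → Fin m → Set
IsRootPath H R x xs z =
  (R z ≡ true) × All (λ y → R y ≡ false) (x ∷ xs) ×
  Unique (x ∷ xs ++ [ z ]) × Linked (Adj H) (x ∷ xs ++ [ z ])

record Rooted {m : ℕ} (H : Graph m) : Set where
  field
    isRoot  : Fin m → Bool
    pathMid : Fin m → List (Fin m)
    pathEnd : Fin m → Fin m
    pathOK  : ∀ x → isRoot x ≡ false → IsRootPath H isRoot x (pathMid x) (pathEnd x)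
    pathUnq : ∀ x → isRoot x ≡ false → ∀ xs z → IsRootPath H isRoot x xs z →
              (xs ≡ pathMid x) × (z ≡ pathEnd x)
  parent : Fin m → Fin m
  parent x = firstOr (pathMid x) (pathEnd x)

IsEmbedding : ∀ {n m t} → Family n t → (Fin n → Bool) → Graph m →
              (Fin m → Fin m → Fin t) → (Fin m → Fin n) → Set
IsEmbedding G V' H col φ =
  Injective _≡_ _≡_ φ × (∀ x → V' (φ x) ≡ true) ×
  (∀ u v → Adj H u v → Adj (G (col u v)) (φ u) (φ v))

inImage : ∀ {n m} → (Fin m → Fin n) → Fin n → Bool
inImage φ w = anyF (λ x → φ x == w)

gammaOut : ∀ {n m t} → Family n t → (Fin n → Bool) → (Fin m → Fin n) → Sub2 n t → ℕ
gammaOut G V' φ X =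
  count (λ w → V' w ∧ not (inImage φ w) ∧
                anyF (λ v → anyF (λ i → X v i ∧ G i v w)))

-- deg_{H_i}(φ⁻¹(v)), = 0 when v ∉ φ(V(H))  (φ injective)
degPre : ∀ {n m t} → Graph m → (Fin m → Fin m → Fin t) → (Fin m → Fin n) →
         Fin t → Fin n → ℕ
degPre H col φ i v = sumF (λ x → if φ x == v then degC H col i x else 0)

pCap : ∀ {n m t} {H : Graph m} → Rooted H → (Fin m → Fin m → Fin t) →
       (Fin m → Fin n) → Sub2 n t → ℕ
pCap {H = H} Rt col φ X =
  card2 (λ v i → X v i ∧
    anyF (λ x → not (Rooted.isRoot Rt x) ∧ (φ x == v) ∧
                (col x (Rooted.parent Rt x) == i)))

-- R(X,φ) ≥ 0, written additively in ℕ: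
-- |Γ(X) ∖ φ(V(H))| - Σ_{(v,i)∈X} (D - deg) - |P ∩ X| ≥ 0
RNonneg : ∀ {n m t} → Family n t → (Fin n → Bool) → (H : Graph m) → Rooted H →
          (Fin m → Fin m → Fin t) → ℕ → (Fin m → Fin n) → Sub2 n t → Set
RNonneg G V' H Rt col D φ X =
  D * card2 X + pCap Rt col φ X ≤
  gammaOut G V' φ X + sumF (λ v → sumF (λ i → if X v i then degPre H col φ i v else 0))

-- φ is (s',D)-good (ambient family 𝓖[V'], so X ⊆ V' × [t])
Good : ∀ {n m t} → Family n t → (Fin n → Bool) → (H : Graph m) → Rooted H →
       (Fin m → Fin m → Fin t) → ℕ → ℕ → (Fin m → Fin n) → Set
Good {n} {m} {t} G V' H Rt col s' D φ =
  (X : Sub2 n t) → (∀ v i → X v i ≡ true → V' v ≡ true) → card2 X ≤ s' →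
  RNonneg G V' H Rt col D φ X

{-# OPTIONS --safe #-}
-- Pairs (v, i) are flattened to Fin (n * t).  A partial embedding is remembered through its host
-- side only: an assignment σ says which host vertices were chosen, and for which pair (parent
-- image, colour).  Choosing every vertex of H as a root makes P_φ(H) empty, so goodness of an
-- assignment is one coverage inequality |{y : S_y ∩ X ≠ ∅}| ≥ D |X|, where S_y is the singleton of
-- the pair served by y, or the set of all pairs adjacent to y if y is still free.
--
-- Coverage is submodular, so sets attaining equality are closed under union; being s-joined forces
-- them to have fewer than s elements, and this lets one serve any pair of load below D by a free
-- neighbour.  Releasing a chosen vertex only enlarges S_y, so any set of choices can be undone.
-- To connect two embedded vertices a and b by a path, one grows a (D - 1)-ary tree from each of
-- them, joins two of the at least s leaves on either side by an edge, and undoes all choices off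
-- the two branches.  A set V∖V′ of fewer than s vertices is removed at the start so that all small
-- sets expand into a fixed set U disjoint from W, whatever the images of the roots in W are.
module Submission where

open import Defs
open import Data.Bool using (Bool; true; false; _∧_; _∨_; not; if_then_else_)
import Data.Bool as Bool
open import Data.Bool.Properties using (¬-not)
open import Data.Empty using (⊥; ⊥-elim)
open import Data.Fin using (Fin) renaming (zero to fzero; suc to fsuc)
import Data.Fin as F
import Data.Fin.Properties as F
open import Data.Fin.Subset.Properties using (anySubset?)
open import Data.List using (List; []; _∷_; _++_; [_]; length; map; replicate; reverse; allFin; _ʳ++_;
  initLast; _∷ʳ′_)
open import Data.List.Membership.Propositional using (_∈_; _∉_)
open import Data.List.Membership.Propositional.Properties
  using (∈-allFin; ∈-++⁻; ∈-++⁺ˡ; ∈-++⁺ʳ; ∈-map⁻; ∈-∃++)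
open import Data.List.Properties using (++-assoc; ++-ʳ++; length-++; length-map; length-replicate;
  length-reverse; reverse-involutive; unfold-reverse; reverse-++; ∷-injectiveˡ; ∷ʳ-injectiveʳ)
open import Data.List.Relation.Binary.Permutation.Propositional using (_↭_; ↭-sym; ↭⇒↭ₛ)
open import Data.List.Relation.Binary.Permutation.Propositional.Properties
  using (All-resp-↭; ∈-resp-↭; ++↭ʳ++; ↭-reverse)
import Data.List.Relation.Binary.Permutation.Setoid.Properties as Setoid↭
open import Data.List.Relation.Unary.All as All using (All; []; _∷_)
import Data.List.Relation.Unary.All.Properties as All
open import Data.List.Relation.Unary.AllPairs using ([]; _∷_)
open import Data.List.Relation.Unary.Any using (here; there)
open import Data.List.Relation.Unary.Linked as Linked using (Linked; []; [-]; _∷_)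
open import Data.List.Relation.Unary.Unique.Propositional using (Unique)
import Data.List.Relation.Unary.Unique.Propositional.Properties as Unique
open import Data.Maybe using (Maybe; just; nothing; is-nothing)
open import Data.Maybe.Properties using (just-injective)
open import Data.Nat using (ℕ; zero; suc; _+_; _*_; _∸_; _^_; _≤_; _<_; z≤n; s≤s)
open import Data.Nat.Properties
open import Data.Nat.Solver using (module +-*-Solver)
open import Data.Product using (Σ; _×_; _,_; proj₁; proj₂; ∃; ∃₂)
open import Data.Sum using (_⊎_; inj₁; inj₂; [_,_]′)
open import Data.Vec using (lookup; tabulate)
open import Data.Vec.Properties using (lookup∘tabulate)
open import Function using (_∘_; case_of_)
open import Function.Definitions using (Injective)
open import Relation.Binary.Construct.Closure.ReflexiveTransitive as Star using (Star; ε; _◅_; _◅◅_)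
open import Relation.Binary.PropositionalEquality hiding ([_])
open import Relation.Nullary using (Dec; yes; no; contradiction)
open import Relation.Nullary.Decidable using (⌊_⌋; map′; _×-dec_; _→-dec_)

-- Counting over Fin

private variable
  ι κ : ℕ

∧-elim : ∀ {a b} → a ∧ b ≡ true → a ≡ true × b ≡ true
∧-elim {true} {true} refl = refl , refl

∧-intro : ∀ {a b} → a ≡ true → b ≡ true → a ∧ b ≡ true
∧-intro refl refl = refl

∨-elim : ∀ {a b} → a ∨ b ≡ true → a ≡ true ⊎ b ≡ true
∨-elim {true}  _ = inj₁ refl
∨-elim {false} e = inj₂ e

∨-introˡ : ∀ {a b} → a ≡ true → a ∨ b ≡ true
∨-introˡ refl = refl

∨-introʳ : ∀ {a b} → b ≡ true → a ∨ b ≡ true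
∨-introʳ {true}  refl = refl
∨-introʳ {false} refl = refl

not-elim : ∀ {a} → not a ≡ true → a ≡ false
not-elim {false} _ = refl

not-intro : ∀ {a} → a ≡ false → not a ≡ true
not-intro refl = refl

true≢false : ∀ {a} → a ≡ true → a ≡ false → ⊥
true≢false refl ()

split : ∀ a → a ≡ true ⊎ a ≡ false
split true  = inj₁ refl
split false = inj₂ refl

==-sound : {x y : Fin κ} → (x == y) ≡ true → x ≡ y
==-sound {x = x} {y} e with x F.≟ y
... | yes x≡y = x≡y
==-sound () | no _

==-refl : (x : Fin κ) → (x == x) ≡ true
==-refl x with x F.≟ x
... | yes _ = refl
... | no ¬p = contradiction refl ¬p

==-complete : {x y : Fin κ} → x ≡ y → (x == y) ≡ true
==-complete {x = x} refl = ==-refl x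

==-false : {x y : Fin κ} → x ≢ y → (x == y) ≡ false
==-false x≢y = ¬-not (x≢y ∘ ==-sound)

anyF-intro : {p : Fin κ → Bool} (x : Fin κ) → p x ≡ true → anyF p ≡ true
anyF-intro fzero    e = ∨-introˡ e
anyF-intro (fsuc x) e = ∨-introʳ (anyF-intro x e)

anyF-elim : {p : Fin κ → Bool} → anyF p ≡ true → ∃ λ x → p x ≡ true
anyF-elim {suc κ} e with ∨-elim e
... | inj₁ e₀ = fzero , e₀
... | inj₂ e₁ with anyF-elim e₁
... | x , ex = fsuc x , ex

sumF-mono : {f g : Fin κ → ℕ} → (∀ x → f x ≤ g x) → sumF f ≤ sumF g
sumF-mono {zero}  f≤g = z≤n
sumF-mono {suc κ} f≤g = +-mono-≤ (f≤g fzero) (sumF-mono (f≤g ∘ fsuc))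

sumF-cong : {f g : Fin κ → ℕ} → (∀ x → f x ≡ g x) → sumF f ≡ sumF g
sumF-cong {zero}  f≡g = refl
sumF-cong {suc κ} f≡g = cong₂ _+_ (f≡g fzero) (sumF-cong (f≡g ∘ fsuc))

+-interchange : ∀ a b c d → (a + b) + (c + d) ≡ (a + c) + (b + d)
+-interchange a b c d = begin
  (a + b) + (c + d) ≡⟨ +-assoc a b (c + d) ⟩
  a + (b + (c + d)) ≡⟨ cong (a +_) (sym (+-assoc b c d)) ⟩
  a + ((b + c) + d) ≡⟨ cong (λ z → a + (z + d)) (+-comm b c) ⟩
  a + ((c + b) + d) ≡⟨ cong (a +_) (+-assoc c b d) ⟩
  a + (c + (b + d)) ≡⟨ sym (+-assoc a c (b + d)) ⟩
  (a + c) + (b + d) ∎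
  where open ≡-Reasoning

sumF-+ : (f g : Fin κ → ℕ) → sumF (λ x → f x + g x) ≡ sumF f + sumF g
sumF-+ {zero}  f g = refl
sumF-+ {suc κ} f g = begin
  (f fzero + g fzero) + sumF (λ x → f (fsuc x) + g (fsuc x))
    ≡⟨ cong ((f fzero + g fzero) +_) (sumF-+ (f ∘ fsuc) (g ∘ fsuc)) ⟩
  (f fzero + g fzero) + (sumF (f ∘ fsuc) + sumF (g ∘ fsuc))
    ≡⟨ +-interchange (f fzero) (g fzero) _ _ ⟩
  sumF f + sumF g ∎
  where open ≡-Reasoning

sumF-zero : sumF {κ} (λ _ → 0) ≡ 0
sumF-zero {zero}  = refl
sumF-zero {suc κ} = sumF-zero {κ}

sumF-swap : (f : Fin ι → Fin κ → ℕ) →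
            sumF (λ x → sumF (f x)) ≡ sumF (λ y → sumF (λ x → f x y))
sumF-swap {zero}  {κ} f = sym (sumF-zero {κ})
sumF-swap {suc ι} f = begin
  sumF (f fzero) + sumF (λ x → sumF (f (fsuc x)))
    ≡⟨ cong (sumF (f fzero) +_) (sumF-swap (f ∘ fsuc)) ⟩
  sumF (f fzero) + sumF (λ y → sumF (λ x → f (fsuc x) y))
    ≡⟨ sym (sumF-+ (f fzero) _) ⟩
  sumF (λ y → f fzero y + sumF (λ x → f (fsuc x) y)) ∎
  where open ≡-Reasoning

term≤sumF : (f : Fin κ → ℕ) (x : Fin κ) → f x ≤ sumF f
term≤sumF f fzero    = m≤m+n (f fzero) _
term≤sumF f (fsuc x) = ≤-trans (term≤sumF (f ∘ fsuc) x) (m≤n+m _ (f fzero))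

𝟙 : Bool → ℕ
𝟙 b = if b then 1 else 0

𝟙-mono : ∀ {a b} → (a ≡ true → b ≡ true) → 𝟙 a ≤ 𝟙 b
𝟙-mono {false} h = z≤n
𝟙-mono {true}  h rewrite h refl = ≤-refl

count-mono : {p q : Fin κ → Bool} → (∀ x → p x ≡ true → q x ≡ true) → count p ≤ count q
count-mono h = sumF-mono (λ x → 𝟙-mono (h x))

count-cong : {p q : Fin κ → Bool} → (∀ x → p x ≡ q x) → count p ≡ count q
count-cong h = sumF-cong (λ x → cong 𝟙 (h x))

count-none : {p : Fin κ → Bool} → (∀ x → p x ≡ false) → count p ≡ 0
count-none {κ} h = trans (count-cong h) (sumF-zero {κ})

count≥1 : {p : Fin κ → Bool} (x : Fin κ) → p x ≡ true → 1 ≤ count p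
count≥1 {p = p} x e = subst (λ b → 𝟙 b ≤ count p) e (term≤sumF (𝟙 ∘ p) x)

count-all : {p : Fin κ → Bool} → (∀ x → p x ≡ true) → count p ≡ κ
count-all {zero}  h = refl
count-all {suc κ} h = cong₂ _+_ (cong 𝟙 (h fzero)) (count-all (h ∘ fsuc))

count≤1 : {p : Fin κ → Bool} → (∀ x y → p x ≡ true → p y ≡ true → x ≡ y) → count p ≤ 1
count≤1 {zero}  h = z≤n
count≤1 {suc κ} {p} h with split (p fzero)
... | inj₁ e rewrite e | count-none {p = p ∘ fsuc}
        (λ x → ¬-not λ ex → case h fzero (fsuc x) e ex of λ ()) = ≤-refl
... | inj₂ e rewrite e = count≤1 (λ x y ex ey → F.suc-injective (h (fsuc x) (fsuc y) ex ey))

count-cover : {p q r : Fin κ → Bool} → (∀ x → p x ≡ true → q x ≡ true ⊎ r x ≡ true) →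
              count p ≤ count q + count r
count-cover {p = p} {q} {r} h =
  ≤-trans (sumF-mono pointwise) (≤-reflexive (sumF-+ (𝟙 ∘ q) (𝟙 ∘ r)))
  where
  pointwise : ∀ x → 𝟙 (p x) ≤ 𝟙 (q x) + 𝟙 (r x)
  pointwise x with p x in e
  ... | false = z≤n
  ... | true with h x e
  ... | inj₁ eq rewrite eq = s≤s z≤n
  ... | inj₂ er rewrite er = m≤n+m 1 _

count-disjoint : {p q r : Fin κ → Bool} → (∀ x → q x ≡ true → p x ≡ true) →
                 (∀ x → r x ≡ true → p x ≡ true) → (∀ x → q x ≡ true → r x ≡ false) →
                 count q + count r ≤ count p
count-disjoint {p = p} {q} {r} q⊆p r⊆p q∩r =
  ≤-trans (≤-reflexive (sym (sumF-+ (𝟙 ∘ q) (𝟙 ∘ r)))) (sumF-mono pointwise)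
  where
  pointwise : ∀ x → 𝟙 (q x) + 𝟙 (r x) ≤ 𝟙 (p x)
  pointwise x with q x in eq
  ... | true rewrite q∩r x eq | q⊆p x eq = ≤-refl
  ... | false = 𝟙-mono (r⊆p x)

count-strict : {p q : Fin κ → Bool} (z : Fin κ) → (∀ x → p x ≡ true → q x ≡ true) →
               p z ≡ false → q z ≡ true → count p < count q
count-strict {p = p} {q} z p⊆q pz qz =
  ≤-trans (+-monoˡ-≤ (count p) (count≥1 {p = z ==_} z (==-refl z)))
    (count-disjoint {p = q} {q = z ==_} {r = p}
      (λ x e → trans (cong q (sym (==-sound e))) qz) p⊆q
      (λ x e → trans (cong p (sym (==-sound e))) pz))

count-off : {p q : Fin κ → Bool} (z : Fin κ) → (∀ x → x ≢ z → p x ≡ true → q x ≡ true) →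
            count p ≤ suc (count q)
count-off {p = p} {q} z h =
  ≤-trans (count-cover {p = p} {q = z ==_} {r = q} cover)
    (+-monoˡ-≤ (count q)
      (count≤1 {p = z ==_} (λ x y ex ey → trans (sym (==-sound ex)) (==-sound ey))))
  where
  cover : ∀ x → p x ≡ true → (z == x) ≡ true ⊎ q x ≡ true
  cover x e with x F.≟ z
  ... | yes refl = inj₁ (==-refl x)
  ... | no  x≢z  = inj₂ (h x x≢z e)

count-image : {p : Fin κ → Bool} {q : Fin ι → Bool} (f : Fin ι → Fin κ) →
              (∀ y → p y ≡ true → ∃ λ x → q x ≡ true × f x ≡ y) → count p ≤ count q
count-image {κ = κ} {ι} {p} {q} f h = begin
  count p                           ≤⟨ sumF-mono lower ⟩
  sumF (λ y → count (λ x → q x ∧ (f x == y))) ≡⟨ sumF-swap (λ y x → 𝟙 (q x ∧ (f x == y))) ⟩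
  sumF (λ x → count (λ y → q x ∧ (f x == y))) ≤⟨ sumF-mono upper ⟩
  count q                           ∎
  where
  open ≤-Reasoning
  lower : ∀ y → 𝟙 (p y) ≤ count (λ x → q x ∧ (f x == y))
  lower y with p y in e
  ... | false = z≤n
  ... | true with h y e
  ... | x , qx , fx≡y = count≥1 {p = λ x → q x ∧ (f x == y)} x (∧-intro qx (==-complete fx≡y))
  upper : ∀ x → count (λ y → q x ∧ (f x == y)) ≤ 𝟙 (q x)
  upper x with q x
  ... | false = ≤-reflexive (sumF-zero {κ})
  ... | true  = count≤1 {p = f x ==_} (λ y z ey ez → trans (sym (==-sound ey)) (==-sound ez))

count-∪∩ : (p q : Fin κ → Bool) →
           count (λ x → p x ∨ q x) + count (λ x → p x ∧ q x) ≡ count p + count q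
count-∪∩ p q = begin
  count (λ x → p x ∨ q x) + count (λ x → p x ∧ q x)
    ≡⟨ sym (sumF-+ (λ x → 𝟙 (p x ∨ q x)) (λ x → 𝟙 (p x ∧ q x))) ⟩
  sumF (λ x → 𝟙 (p x ∨ q x) + 𝟙 (p x ∧ q x))
    ≡⟨ sumF-cong (λ x → pointwise (p x) (q x)) ⟩
  sumF (λ x → 𝟙 (p x) + 𝟙 (q x))
    ≡⟨ sumF-+ (𝟙 ∘ p) (𝟙 ∘ q) ⟩
  count p + count q ∎
  where
  open ≡-Reasoning
  pointwise : ∀ a b → 𝟙 (a ∨ b) + 𝟙 (a ∧ b) ≡ 𝟙 a + 𝟙 b
  pointwise true  true  = refl
  pointwise true  false = refl
  pointwise false true  = refl
  pointwise false false = refl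

unique⇒length≤count : {p : Fin κ → Bool} (xs : List (Fin κ)) → Unique xs →
                      All (λ x → p x ≡ true) xs → length xs ≤ count p
unique⇒length≤count []       _          _          = z≤n
unique⇒length≤count {p = p} (x ∷ xs) (x∉ ∷ uq) (px ∷ pxs) =
  ≤-trans (s≤s (unique⇒length≤count {p = p∖x} xs uq (All.zipWith keep (x∉ , pxs))))
    (count-strict {p = p∖x} {q = p} x (λ y e → proj₁ (∧-elim e)) dropped px)
  where
  p∖x : Fin _ → Bool
  p∖x y = p y ∧ not (x == y)
  keep : ∀ {y} → (x ≢ y) × (p y ≡ true) → p∖x y ≡ true
  keep (x≢y , py) = ∧-intro py (not-intro (==-false x≢y))
  dropped : p∖x x ≡ false
  dropped rewrite px | ==-refl x = refl

count-initial : ∀ {κ} ι → ι ≤ κ → ι ≤ count {κ} (λ x → ⌊ F.toℕ x <? ι ⌋)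
count-initial zero    _ = z≤n
count-initial {suc κ} (suc ι) (s≤s ι≤κ) with 0 <? suc ι
... | no  ¬0<ι = contradiction (s≤s z≤n) ¬0<ι
... | yes _ = s≤s (≤-trans (count-initial ι ι≤κ) (count-mono shift))
  where
  shift : (x : Fin κ) → ⌊ F.toℕ x <? ι ⌋ ≡ true → ⌊ suc (F.toℕ x) <? suc ι ⌋ ≡ true
  shift x e with F.toℕ x <? ι | suc (F.toℕ x) <? suc ι
  ... | yes a | yes _ = refl
  ... | yes a | no ¬b = contradiction (s≤s a) ¬b

count-initial-≤ : ∀ {κ} ι → count {κ} (λ x → ⌊ F.toℕ x <? ι ⌋) ≤ ι
count-initial-≤ {zero}  ι = z≤n
count-initial-≤ {suc κ} zero = ≤-reflexive (count-none {suc κ} (λ _ → refl))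
count-initial-≤ {suc κ} (suc ι) with 0 <? suc ι
... | no ¬0<ι = contradiction (s≤s z≤n) ¬0<ι
... | yes _ = s≤s (≤-trans (count-mono shift) (count-initial-≤ {κ} ι))
  where
  shift : (x : Fin κ) → ⌊ suc (F.toℕ x) <? suc ι ⌋ ≡ true → ⌊ F.toℕ x <? ι ⌋ ≡ true
  shift x e with F.toℕ x <? ι | suc (F.toℕ x) <? suc ι
  ... | yes a | _ = refl
  ... | no ¬a | yes (s≤s b) = contradiction b ¬a

set? : {P : (Fin κ → Bool) → Set} → (∀ {X Y} → (∀ x → X x ≡ Y x) → P X → P Y) →
       (∀ X → Dec (P X)) → Dec (∃ P)
set? {P = P} resp P? = map′
  (λ (X , PX) → lookup X , PX)
  (λ (X , PX) → tabulate X , resp (λ x → sym (lookup∘tabulate X x)) PX)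
  (anySubset? (P? ∘ lookup))

sumF-↑ : ∀ a b (f : Fin (a + b) → ℕ) →
         sumF f ≡ sumF (λ x → f (x F.↑ˡ b)) + sumF (λ y → f (a F.↑ʳ y))
sumF-↑ zero    b f = refl
sumF-↑ (suc a) b f =
  trans (cong (f fzero +_) (sumF-↑ a b (f ∘ fsuc)))
    (sym (+-assoc (f fzero) (sumF (λ x → f (fsuc (x F.↑ˡ b)))) (sumF (λ y → f (fsuc (a F.↑ʳ y))))))

sumF-combine : ∀ a b (f : Fin (a * b) → ℕ) →
               sumF f ≡ sumF (λ x → sumF (λ y → f (F.combine {a} {b} x y)))
sumF-combine zero    b f = refl
sumF-combine (suc a) b f =
  trans (sumF-↑ b (a * b) f) (cong (sumF (λ y → f (y F.↑ˡ a * b)) +_) (sumF-combine a b _))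

-- Lists

mult : ∀ {k} → Fin k → List (Fin k) → ℕ
mult w []        = 0
mult w (w′ ∷ ws) = 𝟙 (w′ == w) + mult w ws

mult-++ : ∀ {k} (w : Fin k) xs ys → mult w (xs ++ ys) ≡ mult w xs + mult w ys
mult-++ w []       ys = refl
mult-++ w (x ∷ xs) ys = trans (cong (𝟙 (x == w) +_) (mult-++ w xs ys)) (sym (+-assoc (𝟙 (x == w)) _ _))

mult-replicate : ∀ {k} (w x : Fin k) j → mult w (replicate j x) ≡ j * 𝟙 (x == w)
mult-replicate w x zero    = refl
mult-replicate w x (suc j) = cong (𝟙 (x == w) +_) (mult-replicate w x j)

dup : ∀ {k} → ℕ → List (Fin k) → List (Fin k)
dup j []       = []
dup j (w ∷ ws) = replicate j w ++ dup j ws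

length-dup : ∀ {k} j (ws : List (Fin k)) → length (dup j ws) ≡ j * length ws
length-dup j []       = sym (*-zeroʳ j)
length-dup j (w ∷ ws) = begin
  length (replicate j w ++ dup j ws)         ≡⟨ length-++ (replicate j w) ⟩
  length (replicate j w) + length (dup j ws) ≡⟨ cong₂ _+_ (length-replicate j) (length-dup j ws) ⟩
  j + j * length ws                          ≡⟨ sym (*-suc j (length ws)) ⟩
  j * suc (length ws)                        ∎
  where open ≡-Reasoning

∈-replicate : ∀ {k} {w x : Fin k} j → w ∈ replicate j x → w ≡ x
∈-replicate (suc j) (here e)  = e
∈-replicate (suc j) (there i) = ∈-replicate j i

∈-dup : ∀ {k} {w : Fin k} j ws → w ∈ dup j ws → w ∈ ws
∈-dup j (x ∷ ws) i with ∈-++⁻ (replicate j x) i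
... | inj₁ i₁ = here (∈-replicate j i₁)
... | inj₂ i₂ = there (∈-dup j ws i₂)

mult-dup-step : ∀ {k} (w x : Fin k) j ws → mult w (dup j (x ∷ ws)) ≡ j * 𝟙 (x == w) + mult w (dup j ws)
mult-dup-step w x j ws =
  trans (mult-++ w (replicate j x) (dup j ws)) (cong (_+ mult w (dup j ws)) (mult-replicate w x j))

mult-dup-absent : ∀ {k} (w : Fin k) j ws → All (w ≢_) ws → mult w (dup j ws) ≡ 0
mult-dup-absent w j []       []          = refl
mult-dup-absent w j (x ∷ ws) (w≢x ∷ w∉) =
  trans (mult-dup-step w x j ws)
    (cong₂ _+_ (trans (cong (λ b → j * 𝟙 b) (==-false (w≢x ∘ sym))) (*-zeroʳ j)) (mult-dup-absent w j ws w∉))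

mult-dup : ∀ {k} (w : Fin k) j ws → Unique ws → mult w (dup j ws) ≤ j
mult-dup w j []       _ = z≤n
mult-dup w j (x ∷ ws) (x∉ ∷ uq) with x F.≟ w
... | yes refl = ≤-reflexive (trans (mult-dup-step w w j ws) (trans
      (cong₂ _+_ (trans (cong (λ b → j * 𝟙 b) (==-refl w)) (*-identityʳ j)) (mult-dup-absent w j ws x∉))
      (+-identityʳ j)))
... | no x≢w = ≤-trans (≤-reflexive (trans (mult-dup-step w x j ws)
      (cong (_+ mult w (dup j ws)) (trans (cong (λ b → j * 𝟙 b) (==-false x≢w)) (*-zeroʳ j)))))
      (mult-dup w j ws uq)

lastOf : ∀ {B : Set} → B → List B → B
lastOf x []       = x
lastOf x (y ∷ ys) = lastOf y ys

module _ {B : Set} where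

  unique-↭ : {xs ys : List B} → xs ↭ ys → Unique xs → Unique ys
  unique-↭ xs↭ys = Setoid↭.Unique-resp-↭ (setoid B) (↭⇒↭ₛ xs↭ys)

  unique-++⁻ : ∀ xs {ys : List B} → Unique (xs ++ ys) →
               Unique xs × Unique ys × (∀ {z} → z ∈ xs → z ∈ ys → ⊥)
  unique-++⁻ []       uq        = [] , uq , λ ()
  unique-++⁻ (x ∷ xs) (x∉ ∷ uq) with unique-++⁻ xs uq
  ... | uxs , uys , disj =
    All.++⁻ˡ xs x∉ ∷ uxs , uys , λ where
      (here refl) z∈ys → All.lookup (All.++⁻ʳ xs x∉) z∈ys refl
      (there z∈)  z∈ys → disj z∈ z∈ys

  split-ʳ++ : ∀ j {k} (xs : List B) → length xs ≡ j + k →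
              ∃₂ λ l r → xs ≡ l ʳ++ r × length l ≡ j × length r ≡ k
  split-ʳ++ j xs e = go j [] xs e
    where
    go : ∀ i {k} acc xs → length xs ≡ i + k →
         ∃₂ λ l r → acc ʳ++ xs ≡ l ʳ++ r × length l ≡ length acc + i × length r ≡ k
    go zero    acc xs       e = acc , xs , refl , sym (+-identityʳ _) , e
    go (suc i) acc (x ∷ xs) e with go i (x ∷ acc) xs (suc-injective e)
    ... | l , r , e₁ , e₂ , e₃ = l , r , e₁ , trans e₂ (sym (+-suc (length acc) i)) , e₃

  ʳ++-++ : ∀ (l : List B) {r zs} → (l ʳ++ r) ++ zs ≡ l ʳ++ (r ++ zs)
  ʳ++-++ []      = refl
  ʳ++-++ (x ∷ l) = ʳ++-++ l

  module _ {R : B → B → Set} where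

    linked-ʳ++ : (∀ {x y} → R x y → R y x) → ∀ xs {x ys} → Linked R (x ∷ xs) → Linked R (x ∷ ys) →
                 Linked R (xs ʳ++ (x ∷ ys))
    linked-ʳ++ R-sym []       _         l = l
    linked-ʳ++ R-sym (z ∷ xs) (r ∷ l₁) l₂ = linked-ʳ++ R-sym xs l₁ (R-sym r ∷ l₂)

    linked-ʳ++⁻ : (∀ {x y} → R x y → R y x) → ∀ xs {x ys} → Linked R (xs ʳ++ (x ∷ ys)) →
                  Linked R (x ∷ xs) × Linked R (x ∷ ys)
    linked-ʳ++⁻ R-sym []       l = [-] , l
    linked-ʳ++⁻ R-sym (z ∷ xs) l with linked-ʳ++⁻ R-sym xs l
    ... | l₁ , r ∷ l₂ = R-sym r ∷ l₁ , l₂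

    linked-lastOf : ∀ x xs {a} → Linked R (x ∷ xs ++ [ a ]) → R (lastOf x xs) a
    linked-lastOf x []       (r ∷ _) = r
    linked-lastOf x (y ∷ xs) (_ ∷ l) = linked-lastOf y xs l

    linked-map : ∀ {P : B → Set} {S : B → B → Set} → (∀ {x y} → P x → P y → R x y → S x y) →
                 ∀ {xs} → All P xs → Linked R xs → Linked S xs
    linked-map f []             []      = []
    linked-map f _              [-]     = [-]
    linked-map f (p ∷ p′ ∷ ps) (r ∷ l) = f p p′ r ∷ linked-map f (p′ ∷ ps) l

  all-lastOf : ∀ {P : B → Set} x xs → All P (x ∷ xs) → P (lastOf x xs)
  all-lastOf x []       (p ∷ _)  = p
  all-lastOf x (y ∷ xs) (_ ∷ ps) = all-lastOf y xs ps

module _ {k : ℕ} {R : Fin k → Fin k → Set} where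

  linked-∷⁻ : ∀ x xs {a} → Linked R (x ∷ xs ++ [ a ]) → R x (firstOr xs a)
  linked-∷⁻ x []       (r ∷ _) = r
  linked-∷⁻ x (y ∷ xs) (r ∷ _) = r

  linked-∷⁺ : ∀ {x} xs {a} → R x (firstOr xs a) → Linked R (xs ++ [ a ]) → Linked R (x ∷ xs ++ [ a ])
  linked-∷⁺ []       r l = r ∷ l
  linked-∷⁺ (y ∷ xs) r l = r ∷ l

all-firstOr : ∀ {k} {P : Fin k → Set} xs {a} → All P (xs ++ [ a ]) → P (firstOr xs a)
all-firstOr []       (p ∷ _) = p
all-firstOr (y ∷ xs) (p ∷ _) = p

elem : ∀ {k} → List (Fin k) → Fin k → Bool
elem []       x = false
elem (y ∷ ys) x = (y == x) ∨ elem ys x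

elem-sound : ∀ {k} (ys : List (Fin k)) {x} → elem ys x ≡ true → x ∈ ys
elem-sound (y ∷ ys) e with ∨-elim {y == _} e
... | inj₁ e′ = here (sym (==-sound e′))
... | inj₂ e′ = there (elem-sound ys e′)

elem-complete : ∀ {k} {ys : List (Fin k)} {x} → x ∈ ys → elem ys x ≡ true
elem-complete {x = x} (here refl) = ∨-introˡ (==-refl x)
elem-complete {ys = y ∷ _} {x} (there i) = ∨-introʳ {y == x} (elem-complete i)

count-elem : ∀ {k} {ys : List (Fin k)} → Unique ys → length ys ≤ count (elem ys)
count-elem {ys = ys} uq = unique⇒length≤count ys uq (All.tabulate elem-complete)

-- Paths, cycles and forests

module _ {B : Set} {R : B → B → Set} where

  linked-∷ʳ : ∀ ws {x z} → Linked R (ws ++ [ x ]) → R x z → Linked R ((ws ++ [ x ]) ++ [ z ])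
  linked-∷ʳ []           l       r = r ∷ [-]
  linked-∷ʳ (y ∷ [])     (r′ ∷ l) r = r′ ∷ linked-∷ʳ [] l r
  linked-∷ʳ (y ∷ w ∷ ws) (r′ ∷ l) r = r′ ∷ linked-∷ʳ (w ∷ ws) l r

  linked-++⁻-middle : ∀ xs {u v ys} → Linked R (xs ++ u ∷ v ∷ ys) → R u v
  linked-++⁻-middle []       (r ∷ _) = r
  linked-++⁻-middle (x ∷ xs) l       = linked-++⁻-middle xs (Linked.tail l)

  linked-reverse : (∀ {x y} → R x y → R y x) → ∀ xs → Linked R xs → Linked R (reverse xs)
  linked-reverse R-sym []       _ = []
  linked-reverse R-sym (x ∷ xs) l = linked-ʳ++ R-sym xs l [-]

module _ {k : ℕ} {R : Fin k → Fin k → Set} where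

  linked⇒edges : (∀ {u v} → R u v → R v u) → ∀ {p} → Linked R p → ∀ u v → EdgeIn p u v → R u v
  linked⇒edges R-sym l u v (inj₁ (xs , ys , refl)) = linked-++⁻-middle xs l
  linked⇒edges R-sym l u v (inj₂ (xs , ys , refl)) = R-sym (linked-++⁻-middle xs l)

  edges⇒linked : ∀ p → (∀ u v → EdgeIn p u v → R u v) → Linked R p
  edges⇒linked []          f = []
  edges⇒linked (x ∷ [])    f = [-]
  edges⇒linked (x ∷ y ∷ p) f = f x y (inj₁ ([] , p , refl)) ∷ edges⇒linked (y ∷ p) λ u v → λ where
    (inj₁ (xs , ys , e)) → f u v (inj₁ (x ∷ xs , ys , cong (x ∷_) e))
    (inj₂ (xs , ys , e)) → f u v (inj₂ (x ∷ xs , ys , cong (x ∷_) e))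

ends : ∀ {k} (p : List (Fin k)) → 2 ≤ length p → ∃₂ λ a mid → ∃ λ b → p ≡ a ∷ mid ++ [ b ]
ends (a ∷ p) 2≤ with initLast p
ends (a ∷ .[]) (s≤s ()) | []
... | mid ∷ʳ′ b = a , mid , b , refl

endpoint-cases : ∀ {k} {a b x : Fin k} mid → Endpoint (a ∷ mid ++ [ b ]) x → x ≡ a ⊎ x ≡ b
endpoint-cases mid (inj₁ (xs , e)) = inj₁ (sym (∷-injectiveˡ e))
endpoint-cases {a = a} mid (inj₂ (xs , e)) = inj₂ (sym (∷ʳ-injectiveʳ (a ∷ mid) xs e))

module _ {k : ℕ} (A : Graph k) where

  Within : (Fin k → Bool) → Fin k → Fin k → Set
  Within Dom u v = Adj A u v × Dom u ≡ true × Dom v ≡ true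

  IsPathTo : (Fin k → Bool) → Fin k → List (Fin k) → Set
  IsPathTo Dom y pre =
    Unique (pre ++ [ y ]) × Linked (Adj A) (pre ++ [ y ]) × All (λ u → Dom u ≡ true) (pre ++ [ y ])

  PathBetween : (Fin k → Bool) → Fin k → Fin k → Set
  PathBetween Dom x y = ∃ λ pre → firstOr pre y ≡ x × IsPathTo Dom y pre

  cut : ∀ {Dom x y} pre → IsPathTo Dom y pre → x ∈ pre ++ [ y ] → PathBetween Dom x y
  cut []        P (here refl)  = [] , refl , P
  cut (z ∷ pre) P (here refl) = z ∷ pre , refl , P
  cut (z ∷ pre) (_ ∷ uq , l , _ ∷ ds) (there x∈) = cut pre (uq , Linked.tail l , ds) x∈

  walk⇒path : ∀ {Dom x y} → Dom y ≡ true → Star (Within Dom) x y → PathBetween Dom x y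
  walk⇒path Dy ε = [] , refl , [] ∷ [] , [-] , Dy ∷ []
  walk⇒path {x = x} {y} Dy ((xz , Dx , _) ◅ w) with walk⇒path Dy w
  ... | pre , refl , P@(uq , l , ds) with split (elem (pre ++ [ y ]) x)
  ... | inj₁ e = cut pre P (elem-sound (pre ++ [ y ]) e)
  ... | inj₂ e = x ∷ pre , refl ,
        All.tabulate (λ { z∈ refl → true≢false (elem-complete z∈) e }) ∷ uq , linked-∷⁺ pre xz l , Dx ∷ ds

  unique-attachment : (∀ c → IsCycle A c → ⊥) → ∀ {Dom x y z} → Dom y ≡ true → Dom z ≡ false →
                      Adj A z x → Adj A y z → Star (Within Dom) x y → x ≡ y
  unique-attachment acyclic {Dom} {x} {y} {z} Dy ¬Dz zx yz w with walk⇒path Dy w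
  ... | [] , refl , _ = refl
  ... | x ∷ pre , refl , uq , l , ds = ⊥-elim (acyclic (z ∷ x ∷ pre ++ [ y ])
        ( s≤s (s≤s (nonempty pre))
        , All.map (λ { Du refl → true≢false Du ¬Dz }) ds ∷ uq
        , zx ∷ linked-∷ʳ (x ∷ pre) l yz ))
    where
    nonempty : ∀ (ws : List (Fin k)) → 1 ≤ length (ws ++ [ y ])
    nonempty []      = s≤s z≤n
    nonempty (_ ∷ _) = s≤s z≤n

forest-unique-parent : ∀ {m r} {V0 : Fin m → Bool} {E0 : Graph m} {h : Fin r → Fin m} →
  RootedForest V0 E0 h → ∀ {Dom x y z} → Dom x ≡ true → Dom y ≡ true → Dom z ≡ false →
  Adj E0 x z → Adj E0 y z →
  ∃ (λ i → Star (Within E0 Dom) (h i) x) → ∃ (λ i → Star (Within E0 Dom) (h i) y) → x ≡ y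
forest-unique-parent {E0 = E0} {h} Fo {Dom} {x} {y} {z} Dx Dy ¬Dz xz yz (i , wx) (j , wy) =
  unique-attachment E0 (RootedForest.acyclic Fo) Dy ¬Dz (sym-E0 xz) yz
    (Star.reverse (λ (e , Du , Dv) → sym-E0 e , Dv , Du) wx ◅◅ subst (λ i → Star (Within E0 Dom) (h i) y) (sym i≡j) wy)
  where
  sym-E0 : ∀ {u v} → Adj E0 u v → Adj E0 v u
  sym-E0 {u} {v} e = trans (sym (proj₁ (RootedForest.simple Fo) u v)) e
  forget : ∀ {u v} → Star (Within E0 Dom) u v → Star (Adj E0) u v
  forget = Star.map proj₁
  i≡j : i ≡ j
  i≡j = RootedForest.rootsSep Fo i j
    (forget wx ◅◅ xz ◅ sym-E0 yz ◅ Star.reverse sym-E0 (forget wy))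

-- Assignments and the extension step

upd : ∀ {k} {B : Set} → (Fin k → B) → Fin k → B → Fin k → B
upd f x b y = if x == y then b else f y

upd-same : ∀ {k} {B : Set} (f : Fin k → B) x b → upd f x b x ≡ b
upd-same f x b rewrite ==-refl x = refl

upd-other : ∀ {k} {B : Set} (f : Fin k → B) x b {y} → x ≢ y → upd f x b y ≡ f y
upd-other f x b x≢y rewrite ==-false x≢y = refl

names : ∀ {N} → Maybe (Fin N) → Fin N → Bool
names nothing  p = false
names (just q) p = q == p

names-sound : ∀ {N} (a : Maybe (Fin N)) {p} → names a p ≡ true → a ≡ just p
names-sound (just q) e = cong just (==-sound e)

names-just : ∀ {N} {a : Maybe (Fin N)} {p} → a ≡ just p → names a p ≡ true
names-just {p = p} refl = ==-refl p

Joined : ∀ {N n} → ℕ → (Fin N → Fin n → Bool) → Set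
Joined {N} {n} s Γ = (X : Fin N → Bool) (Y : Fin n → Bool) → s ≤ count X → s ≤ count Y →
  Σ (Fin N) λ p → Σ (Fin n) λ y → X p ≡ true × Y y ≡ true × Γ p y ≡ true

module Assignment {N n : ℕ} (D s : ℕ) (Γ : Fin N → Fin n → Bool)
                  (ok : Fin N → Bool) (A : Fin n → Bool) (joined : Joined s Γ) where

  -- σ y ≡ just p records that the host vertex y has been used to serve the source p.
  Asg : Set
  Asg = Fin n → Maybe (Fin N)

  free : Asg → Fin n → Bool
  free σ y = A y ∧ is-nothing (σ y)

  link : Maybe (Fin N) → Fin n → Fin N → Bool
  link nothing  y p = A y ∧ Γ p y
  link (just q) y p = q == p

  hit : Asg → (Fin N → Bool) → Fin n → Bool
  hit σ X y = anyF (λ p → X p ∧ link (σ y) y p)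

  cov : Asg → (Fin N → Bool) → ℕ
  cov σ X = count (hit σ X)

  load : Asg → Fin N → ℕ
  load σ p = count (λ y → names (σ y) p)

  -- The condition R(X, φ) ≥ 0 with both sides moved and merged into one count: a free
  -- vertex counts when it is a neighbour of X, an assigned one when its source lies in X.
  Expands : Asg → Set
  Expands σ = ∀ X → (∀ p → X p ≡ true → ok p ≡ true) → count X ≤ 2 * s → D * count X ≤ cov σ X

  Valid : Asg → Set
  Valid σ = ∀ y p → σ y ≡ just p → A y ≡ true × Γ p y ≡ true

  _⊑_ : Asg → Asg → Set
  σ ⊑ τ = ∀ y → σ y ≡ nothing ⊎ σ y ≡ τ y

  ⊑-refl : ∀ {σ} → σ ⊑ σ
  ⊑-refl y = inj₂ refl

  ⊑-trans : ∀ {ρ σ τ} → ρ ⊑ σ → σ ⊑ τ → ρ ⊑ τ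
  ⊑-trans ρσ στ y with ρσ y
  ... | inj₁ e = inj₁ e
  ... | inj₂ e with στ y
  ... | inj₁ e′ = inj₁ (trans e e′)
  ... | inj₂ e′ = inj₂ (trans e e′)

  ⊑-just : ∀ {σ τ} → σ ⊑ τ → ∀ {y p} → σ y ≡ just p → τ y ≡ just p
  ⊑-just στ {y} e with στ y
  ... | inj₁ e′ = case trans (sym e) e′ of λ ()
  ... | inj₂ e′ = trans (sym e′) e

  free-nothing : ∀ σ {y} → free σ y ≡ true → σ y ≡ nothing
  free-nothing σ {y} e with σ y | proj₂ (∧-elim {A y} e)
  ... | nothing | _ = refl

  free-⊑ : ∀ {σ τ} → σ ⊑ τ → ∀ {y} → free τ y ≡ true → free σ y ≡ true
  free-⊑ {σ} {τ} στ {y} e with στ y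
  ... | inj₁ e′ rewrite e′ = ∧-intro (proj₁ (∧-elim {A y} e)) refl
  ... | inj₂ e′ rewrite e′ = e

  occupied-⊑ : ∀ {σ τ} → σ ⊑ τ → ∀ {y} → free σ y ≡ false → free τ y ≡ false
  occupied-⊑ στ e = ¬-not λ e′ → true≢false (free-⊑ στ e′) e

  assigned-occupied : ∀ σ {y p} → σ y ≡ just p → free σ y ≡ false
  assigned-occupied σ {y} e = ¬-not λ e′ → case trans (sym e) (free-nothing σ e′) of λ ()

  hit-elim : ∀ σ X {y} → hit σ X y ≡ true → ∃ λ p → X p ≡ true × link (σ y) y p ≡ true
  hit-elim σ X {y} e with anyF-elim {p = λ p → X p ∧ link (σ y) y p} e
  ... | p , e′ = p , ∧-elim e′

  hit-intro : ∀ σ X {y} p → X p ≡ true → link (σ y) y p ≡ true → hit σ X y ≡ true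
  hit-intro σ X {y} p Xp lp = anyF-intro {p = λ p → X p ∧ link (σ y) y p} p (∧-intro Xp lp)

  hit-mono : ∀ σ {X Y} → (∀ p → X p ≡ true → Y p ≡ true) → ∀ {y} → hit σ X y ≡ true → hit σ Y y ≡ true
  hit-mono σ {X} {Y} X⊆Y h with hit-elim σ X h
  ... | p , Xp , lp = hit-intro σ Y p (X⊆Y p Xp) lp

  hit-⊑ : ∀ {σ τ} → Valid τ → σ ⊑ τ → ∀ X y → hit τ X y ≡ true → hit σ X y ≡ true
  hit-⊑ {σ} {τ} vτ στ X y h with hit-elim τ X h
  ... | p , Xp , lp = hit-intro σ X p Xp (relink (στ y))
    where
    relink : σ y ≡ nothing ⊎ σ y ≡ τ y → link (σ y) y p ≡ true
    relink (inj₂ e) rewrite e = lp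
    relink (inj₁ e) rewrite e with τ y in eτ
    ... | nothing = lp
    ... | just q with ==-sound {x = q} lp
    ... | refl with vτ y q eτ
    ... | Ay , Γqy = ∧-intro Ay Γqy

  good-⊑ : ∀ {σ τ} → Valid τ → σ ⊑ τ → Expands τ → Expands σ
  good-⊑ vτ στ gτ X X⊆ok X≤ = ≤-trans (gτ X X⊆ok X≤) (count-mono (hit-⊑ vτ στ X))

  valid-⊑ : ∀ {σ τ} → Valid τ → σ ⊑ τ → Valid σ
  valid-⊑ vτ στ y p e = vτ y p (⊑-just στ e)

  assign : Asg → Fin n → Fin N → Asg
  assign σ y p = upd σ y (just p)

  ⊑-assign : ∀ σ {y} p → free σ y ≡ true → σ ⊑ assign σ y p
  ⊑-assign σ {y} p fy z with y F.≟ z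
  ... | yes refl = inj₁ (free-nothing σ fy)
  ... | no  _    = inj₂ refl

  assign-⊑ : ∀ {σ τ y p} → σ ⊑ τ → τ y ≡ just p → assign σ y p ⊑ τ
  assign-⊑ {y = y} στ e z with y F.≟ z
  ... | yes refl = inj₂ (sym e)
  ... | no  _    = στ z

  assign-inv : ∀ σ y p {z q} → assign σ y p z ≡ just q → (y ≡ z × p ≡ q) ⊎ σ z ≡ just q
  assign-inv σ y p {z} e with y F.≟ z
  ... | yes y≡z = inj₁ (y≡z , just-injective e)
  ... | no  _   = inj₂ e

  free-assign : ∀ σ y p → count (free σ) ≤ suc (count (free (assign σ y p)))
  free-assign σ y p = count-off {p = free σ} {q = free (assign σ y p)} y
    (λ z z≢y e → trans (cong (λ a → A z ∧ is-nothing a) (upd-other σ y (just p) (z≢y ∘ sym))) e)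

  valid-assign : ∀ {σ y p} → Valid σ → A y ≡ true → Γ p y ≡ true → Valid (assign σ y p)
  valid-assign {σ} {y} {p} vσ Ay Γpy z q e with assign-inv σ y p e
  ... | inj₁ (refl , refl) = Ay , Γpy
  ... | inj₂ e′ = vσ z q e′

  large-covers : ∀ σ X → 2 * s * D + s ≤ count (free σ) → s ≤ count X → 2 * s * D < cov σ X
  large-covers σ X room sX with s ≤? count (λ y → free σ y ∧ not (hit σ X y))
  ... | yes sY with joined X (λ y → free σ y ∧ not (hit σ X y)) sX sY
  ...   | p , y , Xp , Yy , Γpy with ∧-elim {free σ y} Yy
  ...   | fy , nh = ⊥-elim (true≢false (hit-intro σ X p Xp lp) (not-elim nh))
    where
    lp : link (σ y) y p ≡ true
    lp rewrite free-nothing σ fy = ∧-intro (proj₁ (∧-elim {A y} fy)) Γpy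
  large-covers σ X room sX | no ¬sY =
    +-cancelʳ-< s (2 * s * D) (cov σ X) (≤-trans (s≤s room) (≤-trans (s≤s split-free) (≤-trans
      (≤-reflexive (sym (+-suc (cov σ X) _))) (+-monoʳ-≤ (cov σ X) (≰⇒> ¬sY)))))
    where
    split-free : count (free σ) ≤ cov σ X + count (λ y → free σ y ∧ not (hit σ X y))
    split-free = count-cover {p = free σ} {q = hit σ X} {r = λ y → free σ y ∧ not (hit σ X y)} λ y fy →
      case split (hit σ X y) of λ where
        (inj₁ h) → inj₁ h
        (inj₂ h) → inj₂ (∧-intro fy (not-intro h))

  record Critical (σ : Asg) (X : Fin N → Bool) : Set where
    constructor critical
    field
      ⊆ok   : ∀ p → X p ≡ true → ok p ≡ true
      small : count X < s
      tight : cov σ X ≤ D * count X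

  size-bound : ∀ {x} → x ≤ 2 * s → D * x ≤ 2 * s * D
  size-bound {x} x≤ = ≤-trans (*-monoʳ-≤ D x≤) (≤-reflexive (*-comm D (2 * s)))

  tight⇒small : ∀ σ X → 2 * s * D + s ≤ count (free σ) → count X ≤ 2 * s →
                cov σ X ≤ D * count X → count X < s
  tight⇒small σ X room X≤ tight = ≰⇒> λ sX →
    <-irrefl refl (<-≤-trans (large-covers σ X room sX) (≤-trans tight (size-bound X≤)))

  small⇒≤2s : ∀ {x} → x < s → x ≤ 2 * s
  small⇒≤2s x<s = ≤-trans (<⇒≤ x<s) (m≤m+n s _)

  cov-∪∩ : ∀ σ X Y → cov σ (λ p → X p ∨ Y p) + cov σ (λ p → X p ∧ Y p) ≤ cov σ X + cov σ Y
  cov-∪∩ σ X Y = begin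
    cov σ X∪Y + cov σ X∩Y
      ≤⟨ +-mono-≤ (count-mono {p = hit σ X∪Y} hit-∪) (count-mono {p = hit σ X∩Y} hit-∩) ⟩
    count (λ y → hit σ X y ∨ hit σ Y y) + count (λ y → hit σ X y ∧ hit σ Y y)
      ≡⟨ count-∪∩ (hit σ X) (hit σ Y) ⟩
    cov σ X + cov σ Y ∎
    where
    open ≤-Reasoning
    X∪Y X∩Y : Fin N → Bool
    X∪Y p = X p ∨ Y p
    X∩Y p = X p ∧ Y p
    hit-∪ : ∀ y → hit σ X∪Y y ≡ true → hit σ X y ∨ hit σ Y y ≡ true
    hit-∪ y h with hit-elim σ X∪Y h
    ... | p , e , lp with ∨-elim {X p} e
    ... | inj₁ Xp = ∨-introˡ (hit-intro σ X p Xp lp)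
    ... | inj₂ Yp = ∨-introʳ (hit-intro σ Y p Yp lp)
    hit-∩ : ∀ y → hit σ X∩Y y ≡ true → hit σ X y ∧ hit σ Y y ≡ true
    hit-∩ y h = ∧-intro (hit-mono σ {X∩Y} (λ p → proj₁ ∘ ∧-elim {X p}) h)
                        (hit-mono σ {X∩Y} (λ p → proj₂ ∘ ∧-elim {X p}) h)

  critical-∅ : ∀ σ → 1 ≤ s → Critical σ (λ _ → false)
  critical-∅ σ 1≤s = critical (λ _ ()) (≤-trans (s≤s (≤-reflexive (count-none {N} (λ _ → refl)))) 1≤s)
    (≤-trans (≤-reflexive (count-none {p = hit σ (λ _ → false)} nohit)) z≤n)
    where
    nohit : ∀ y → hit σ (λ _ → false) y ≡ false
    nohit y = ¬-not λ h → case proj₁ (proj₂ (hit-elim σ (λ _ → false) {y} h)) of λ ()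

  critical-∪ : ∀ {σ X Y} → Expands σ → 2 * s * D + s ≤ count (free σ) →
               Critical σ X → Critical σ Y → Critical σ (λ p → X p ∨ Y p)
  critical-∪ {σ} {X} {Y} gσ room (critical X⊆ sX tX) (critical Y⊆ sY tY) =
    critical (λ p → [ X⊆ p , Y⊆ p ]′ ∘ ∨-elim {X p}) (tight⇒small σ X∪Y room X∪Y≤ tight) tight
    where
    open ≤-Reasoning
    X∪Y X∩Y : Fin N → Bool
    X∪Y p = X p ∨ Y p
    X∩Y p = X p ∧ Y p
    X∪Y≤ : count X∪Y ≤ 2 * s
    X∪Y≤ = begin
      count X∪Y               ≤⟨ m≤m+n _ (count X∩Y) ⟩
      count X∪Y + count X∩Y   ≡⟨ count-∪∩ X Y ⟩
      count X + count Y       ≤⟨ +-mono-≤ (<⇒≤ sX) (<⇒≤ sY) ⟩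
      s + s                   ≡⟨ cong (s +_) (sym (+-identityʳ s)) ⟩
      2 * s                   ∎
    ∩good : D * count X∩Y ≤ cov σ X∩Y
    ∩good = gσ X∩Y (λ p → X⊆ p ∘ proj₁ ∘ ∧-elim {X p})
      (≤-trans (count-mono {p = X∩Y} {q = X} (λ p → proj₁ ∘ ∧-elim {X p})) (small⇒≤2s sX))
    tight : cov σ X∪Y ≤ D * count X∪Y
    tight = +-cancelʳ-≤ (D * count X∩Y) _ _ (begin
      cov σ X∪Y + D * count X∩Y             ≤⟨ +-monoʳ-≤ _ ∩good ⟩
      cov σ X∪Y + cov σ X∩Y                 ≤⟨ cov-∪∩ σ X Y ⟩
      cov σ X + cov σ Y                     ≤⟨ +-mono-≤ tX tY ⟩
      D * count X + D * count Y             ≡⟨ sym (*-distribˡ-+ D (count X) (count Y)) ⟩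
      D * (count X + count Y)               ≡⟨ cong (D *_) (sym (count-∪∩ X Y)) ⟩
      D * (count X∪Y + count X∩Y)           ≡⟨ *-distribˡ-+ D (count X∪Y) (count X∩Y) ⟩
      D * count X∪Y + D * count X∩Y         ∎)

  Bad : Asg → (Fin N → Bool) → Set
  Bad σ X = (∀ p → X p ≡ true → ok p ≡ true) × count X ≤ 2 * s × cov σ X < D * count X

  bad-resp : ∀ σ {X Y} → (∀ p → X p ≡ Y p) → Bad σ X → Bad σ Y
  bad-resp σ {X} {Y} X≗Y (X⊆ , X≤ , bad) =
    (λ p Yp → X⊆ p (trans (X≗Y p) Yp)) ,
    subst (_≤ 2 * s) count≡ X≤ ,
    subst₂ _<_ (≤-antisym (count-mono {p = hit σ X} (λ y → hit-mono σ {X} {Y} (λ p e → trans (sym (X≗Y p)) e)))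
                          (count-mono {p = hit σ Y} (λ y → hit-mono σ {Y} {X} (λ p e → trans (X≗Y p) e))))
      (cong (D *_) count≡) bad
    where
    count≡ : count X ≡ count Y
    count≡ = count-cong {p = X} {q = Y} X≗Y

  bad? : ∀ σ → Dec (∃ (Bad σ))
  bad? σ = set? (bad-resp σ) λ X →
    F.all? (λ p → (X p Bool.≟ true) →-dec (ok p Bool.≟ true)) ×-dec
    (count X ≤? 2 * s) ×-dec (cov σ X <? D * count X)

  good⊎bad : ∀ σ → Expands σ ⊎ ∃ (Bad σ)
  good⊎bad σ with bad? σ
  ... | yes b = inj₂ b
  ... | no ¬b = inj₁ λ X X⊆ X≤ → ≮⇒≥ λ lt → ¬b (X , X⊆ , X≤ , lt)

  bad⇒critical : ∀ {σ y p} → Expands σ → 2 * s * D + s ≤ count (free σ) → free σ y ≡ true →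
                 ∀ X → Bad (assign σ y p) X → Critical σ X × X p ≡ false × hit σ X y ≡ true
  bad⇒critical {σ} {y} {p} gσ room fy X (X⊆ , X≤ , bad) =
    critical X⊆ (tight⇒small σ X room X≤ tight) tight ,
    ¬-not (λ Xp → not-covered λ _ → hit-intro σ′ X p Xp lp) ,
    (case split (hit σ X y) of λ where
       (inj₁ h) → h
       (inj₂ h) → ⊥-elim (not-covered λ h′ → ⊥-elim (true≢false h′ h)))
    where
    σ′ : Asg
    σ′ = assign σ y p
    lp : link (σ′ y) y p ≡ true
    lp rewrite ==-refl y = ==-refl p
    elsewhere : ∀ z → z ≢ y → hit σ X z ≡ true → hit σ′ X z ≡ true
    elsewhere z z≢y h =
      subst (λ a → anyF (λ q → X q ∧ link a z q) ≡ true) (sym (upd-other σ y (just p) (z≢y ∘ sym))) h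
    tight : cov σ X ≤ D * count X
    tight = ≤-trans (count-off {p = hit σ X} {q = hit σ′ X} y elsewhere) bad
    not-covered : (hit σ X y ≡ true → hit σ′ X y ≡ true) → ⊥
    not-covered h = <-irrefl refl (<-≤-trans bad (≤-trans (gσ X X⊆ X≤)
      (count-mono {p = hit σ X} {q = hit σ′ X} λ z → case z F.≟ y of λ where
        (yes refl) → h
        (no z≢y)   → elsewhere z z≢y)))

  -- If no candidate y worked, the union of the resulting critical sets would be a critical
  -- set covering all free neighbours of p, and adding p to it would violate goodness.
  abstract
    extend : ∀ {σ p} → 1 ≤ s → Expands σ → 2 * s * D + s ≤ count (free σ) →
             ok p ≡ true → load σ p < D →
             ∃ λ y → free σ y ≡ true × Γ p y ≡ true × Expands (assign σ y p)
    extend {σ} {p} 1≤s gσ room okp load<D with search (allFin n)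
      where
      search : ∀ ys →
        (∃ λ y → free σ y ≡ true × Γ p y ≡ true × Expands (assign σ y p)) ⊎
        (∃ λ X → Critical σ X × X p ≡ false ×
          All (λ y → free σ y ≡ true → Γ p y ≡ true → hit σ X y ≡ true) ys)
      search [] = inj₂ ((λ _ → false) , critical-∅ σ 1≤s , refl , [])
      search (y ∷ ys) with search ys
      ... | inj₁ found = inj₁ found
      ... | inj₂ (X , cX , Xp , covers) with split (free σ y ∧ Γ p y)
      ... | inj₂ e = inj₂ (X , cX , Xp , (λ fy Γpy → ⊥-elim (true≢false (∧-intro fy Γpy) e)) ∷ covers)
      ... | inj₁ e with ∧-elim {free σ y} e
      ... | fy , Γpy with good⊎bad (assign σ y p)
      ... | inj₁ g = inj₁ (y , fy , Γpy , g)
      ... | inj₂ (Y , bY) with bad⇒critical {p = p} gσ room fy Y bY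
      ... | cY , Yp , hY = inj₂
        ( (λ q → X q ∨ Y q) , critical-∪ gσ room cX cY , cong₂ _∨_ Xp Yp
        , (λ _ _ → hit-mono σ {Y} (λ q → ∨-introʳ {X q}) hY)
          ∷ All.map (λ h fz Γpz → hit-mono σ {X} (λ q → ∨-introˡ) (h fz Γpz)) covers )
    ... | inj₁ found = found
    ... | inj₂ (X , critical X⊆ X<s tX , Xp , covers) = ⊥-elim (<-irrefl refl (begin-strict
        D * count X + D           ≡⟨ trans (+-comm _ D) (sym (*-suc D (count X))) ⟩
        D * suc (count X)         ≤⟨ *-monoʳ-≤ D larger ⟩
        D * count X⁺              ≤⟨ gσ X⁺ X⁺⊆ X⁺≤ ⟩
        cov σ X⁺                  ≤⟨ count-cover {p = hit σ X⁺} {q = hit σ X} {r = λ y → names (σ y) p} newly ⟩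
        cov σ X + load σ p        <⟨ +-mono-≤-< tX load<D ⟩
        D * count X + D           ∎))
      where
      open ≤-Reasoning
      X⁺ : Fin N → Bool
      X⁺ q = X q ∨ (p == q)
      larger : suc (count X) ≤ count X⁺
      larger = count-strict {p = X} {q = X⁺} p (λ _ → ∨-introˡ) Xp (∨-introʳ {X p} (==-refl p))
      X⁺≤ : count X⁺ ≤ 2 * s
      X⁺≤ = begin
        count X⁺           ≤⟨ count-off {p = X⁺} {q = X} p (λ q q≢p e → case ∨-elim {X q} e of λ where
                                (inj₁ Xq) → Xq
                                (inj₂ e′) → ⊥-elim (q≢p (sym (==-sound e′)))) ⟩
        suc (count X)      ≤⟨ X<s ⟩
        s                  ≤⟨ m≤m+n s _ ⟩
        2 * s              ∎
      X⁺⊆ : ∀ q → X⁺ q ≡ true → ok q ≡ true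
      X⁺⊆ q e with ∨-elim {X q} e
      ... | inj₁ Xq = X⊆ q Xq
      ... | inj₂ e′ = subst (λ z → ok z ≡ true) (==-sound e′) okp
      newly : ∀ y → hit σ X⁺ y ≡ true → hit σ X y ≡ true ⊎ names (σ y) p ≡ true
      newly y h with hit-elim σ X⁺ h
      ... | q , e , lq with ∨-elim {X q} e
      ... | inj₁ Xq = inj₁ (hit-intro σ X q Xq lq)
      ... | inj₂ e′ with ==-sound {x = p} e′
      ... | refl with σ y in eσ
      ... | just r = inj₂ lq
      ... | nothing with ∧-elim {A y} lq
      ... | Ay , Γpy = inj₁ (subst (λ a → anyF (λ q → X q ∧ link a y q) ≡ true) eσ
               (All.lookup covers (∈-allFin y) (∧-intro Ay (cong is-nothing eσ)) Γpy))

  cov-split : ∀ σ X → cov σ X ≤ count (λ y → free σ y ∧ anyF (λ p → X p ∧ Γ p y)) +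
                                sumF (λ p → if X p then load σ p else 0)
  cov-split σ X = begin
    cov σ X
      ≤⟨ sumF-mono pointwise ⟩
    sumF (λ y → 𝟙 (freeNbr y) + count (λ p → X p ∧ names (σ y) p))
      ≡⟨ sumF-+ (𝟙 ∘ freeNbr) (λ y → count (λ p → X p ∧ names (σ y) p)) ⟩
    count freeNbr + sumF (λ y → count (λ p → X p ∧ names (σ y) p))
      ≡⟨ cong (count freeNbr +_) (sumF-swap (λ y p → 𝟙 (X p ∧ names (σ y) p))) ⟩
    count freeNbr + sumF (λ p → count (λ y → X p ∧ names (σ y) p))
      ≤⟨ +-monoʳ-≤ (count freeNbr) (sumF-mono restrict) ⟩
    count freeNbr + sumF (λ p → if X p then load σ p else 0) ∎
    where
    open ≤-Reasoning
    freeNbr : Fin n → Bool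
    freeNbr y = free σ y ∧ anyF (λ p → X p ∧ Γ p y)
    restrict : ∀ p → count (λ y → X p ∧ names (σ y) p) ≤ (if X p then load σ p else 0)
    restrict p with X p
    ... | true  = ≤-refl
    ... | false = ≤-reflexive (count-none {n} (λ _ → refl))
    pointwise : ∀ y → 𝟙 (hit σ X y) ≤ 𝟙 (freeNbr y) + count (λ p → X p ∧ names (σ y) p)
    pointwise y with hit σ X y in eh
    ... | false = z≤n
    ... | true with hit-elim σ X eh
    ... | p , Xp , lp with σ y
    ... | just r = ≤-trans (count≥1 {p = λ p → X p ∧ (r == p)} p (∧-intro Xp lp)) (m≤n+m _ (𝟙 ((A y ∧ false) ∧ _)))
    ... | nothing with ∧-elim {A y} lp
    ... | Ay , Γpy = ≤-trans (≤-reflexive (cong 𝟙 (sym both))) (m≤m+n _ _)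
      where
      both : (A y ∧ true) ∧ anyF (λ p → X p ∧ Γ p y) ≡ true
      both = ∧-intro (∧-intro Ay refl) (anyF-intro {p = λ p → X p ∧ Γ p y} p (∧-intro Xp Γpy))

-- Pruning

module Pruning {N n : ℕ} (D s : ℕ) (Γ : Fin N → Fin n → Bool) (π : Fin N → Fin n)
               (joined : Joined s Γ) (U : Fin n → Bool) (largeU : 3 * s * D + 4 * s ≤ count U) where

  covers : (Fin N → Bool) → Fin n → Bool
  covers X v = anyF (λ p → X p ∧ (π p == v))

  nbr : (Fin N → Bool) → Fin n → Bool
  nbr X y = anyF (λ p → X p ∧ Γ p y)

  seen : (Fin N → Bool) → (Fin N → Bool) → Fin n → Bool
  seen X Y y = (U y ∧ not (covers X y)) ∧ nbr Y y

  Pruned : (Fin n → Bool) → Set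
  Pruned V′ = n ≤ count V′ + s ×
    (∀ X → (∀ p → X p ≡ true → V′ (π p) ≡ true) → count X ≤ 2 * s →
      D * count X ≤ count (λ y → (U y ∧ V′ y) ∧ nbr X y))

  any∧-mono : ∀ {X Y : Fin N → Bool} (f : Fin N → Bool) → (∀ p → X p ≡ true → Y p ≡ true) →
              anyF (λ p → X p ∧ f p) ≡ true → anyF (λ p → Y p ∧ f p) ≡ true
  any∧-mono {X} {Y} f X⊆Y e with anyF-elim {p = λ p → X p ∧ f p} e
  ... | p , e′ with ∧-elim {X p} e′
  ... | Xp , fp = anyF-intro {p = λ p → Y p ∧ f p} p (∧-intro (X⊆Y p Xp) fp)

  any∧-∪ : ∀ {X Y : Fin N → Bool} (f : Fin N → Bool) →
           anyF (λ p → (X p ∨ Y p) ∧ f p) ≡ true →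
           anyF (λ p → X p ∧ f p) ≡ true ⊎ anyF (λ p → Y p ∧ f p) ≡ true
  any∧-∪ {X} {Y} f e with anyF-elim {p = λ p → (X p ∨ Y p) ∧ f p} e
  ... | p , e′ with ∧-elim {X p ∨ Y p} e′
  ... | XYp , fp with ∨-elim {X p} XYp
  ... | inj₁ Xp = inj₁ (anyF-intro {p = λ p → X p ∧ f p} p (∧-intro Xp fp))
  ... | inj₂ Yp = inj₂ (anyF-intro {p = λ p → Y p ∧ f p} p (∧-intro Yp fp))

  covers-≤ : ∀ X → count (covers X) ≤ count X
  covers-≤ X = count-image {p = covers X} {q = X} π λ v e →
    let p , e′ = anyF-elim {p = λ p → X p ∧ (π p == v)} e
        Xp , πp = ∧-elim {X p} e′
    in p , Xp , ==-sound πp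

  covers-intro : ∀ X p → X p ≡ true → covers X (π p) ≡ true
  covers-intro X p Xp = anyF-intro {p = λ q → X q ∧ (π q == π p)} p (∧-intro Xp (==-refl (π p)))

  seen-∪ : ∀ X Y y → seen (λ p → X p ∨ Y p) (λ p → X p ∨ Y p) y ≡ true →
           seen X X y ≡ true ⊎ seen X Y y ≡ true
  seen-∪ X Y y e with ∧-elim {U y ∧ not (covers (λ p → X p ∨ Y p) y)} e
  ... | e₁ , nb with ∧-elim {U y} e₁
  ... | Uy , out with any∧-∪ {X} {Y} (λ p → Γ p y) nb
  ... | nbs = [ inj₁ ∘ ∧-intro outX , inj₂ ∘ ∧-intro outX ]′ nbs
    where
    outX : U y ∧ not (covers X y) ≡ true
    outX = ∧-intro Uy (not-intro (¬-not λ c →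
      true≢false (any∧-mono {X} (λ p → π p == y) (λ p → ∨-introˡ) c) (not-elim out)))

  sparse-small : ∀ Z → count Z ≤ 3 * s → count (seen Z Z) ≤ D * count Z → count Z < s
  sparse-small Z Z≤ sparse = ≰⇒> λ s≤Z → <-irrefl refl (begin-strict
    3 * s * D + 4 * s
      ≤⟨ largeU ⟩
    count U
      ≤⟨ count-cover {p = U} {q = seen Z Z} {r = rest} classify ⟩
    count (seen Z Z) + count rest
      ≤⟨ +-monoʳ-≤ _ (count-cover {p = rest} {q = covers Z} {r = λ y → not (nbr Z y)} (λ y → ∨-elim)) ⟩
    count (seen Z Z) + (count (covers Z) + count (λ y → not (nbr Z y)))
      <⟨ +-mono-≤-< (≤-trans sparse (*-monoʳ-≤ D Z≤)) (+-mono-≤-< (≤-trans (covers-≤ Z) Z≤) (unseen s≤Z)) ⟩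
    D * (3 * s) + (3 * s + s)
      ≡⟨ solve 2 (λ D s → D :* (con 3 :* s) :+ (con 3 :* s :+ s) := con 3 :* s :* D :+ con 4 :* s) refl D s ⟩
    3 * s * D + 4 * s ∎)
    where
    open ≤-Reasoning
    open +-*-Solver
    rest : Fin n → Bool
    rest y = covers Z y ∨ not (nbr Z y)
    classify : ∀ y → U y ≡ true → seen Z Z y ≡ true ⊎ rest y ≡ true
    classify y Uy with covers Z y | nbr Z y
    ... | true  | _     = inj₂ refl
    ... | false | false = inj₂ refl
    ... | false | true  rewrite Uy = inj₁ refl
    unseen : s ≤ count Z → count (λ y → not (nbr Z y)) < s
    unseen s≤Z = ≰⇒> λ s≤Y →
      let p , y , Zp , ny , Γpy = joined Z (λ y → not (nbr Z y)) s≤Z s≤Y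
      in true≢false (anyF-intro {p = λ q → Z q ∧ Γ q y} p (∧-intro Zp Γpy)) (not-elim ny)

  Sparse : (Fin N → Bool) → (Fin N → Bool) → Set
  Sparse X Y = (∀ p → Y p ≡ true → not (covers X (π p)) ≡ true) × count Y ≤ 2 * s ×
               count (seen X Y) < D * count Y

  sparse? : ∀ X → Dec (∃ (Sparse X))
  sparse? X = set? sparse-≗ λ Y →
    F.all? (λ p → (Y p Bool.≟ true) →-dec (not (covers X (π p)) Bool.≟ true)) ×-dec
    (count Y ≤? 2 * s) ×-dec (count (seen X Y) <? D * count Y)
    where
    sparse-≗ : ∀ {Y Z} → (∀ p → Y p ≡ Z p) → Sparse X Y → Sparse X Z
    sparse-≗ {Y} {Z} Y≗Z (out , Y≤ , sparse) =
      (λ p Zp → out p (trans (Y≗Z p) Zp)) , subst (_≤ 2 * s) (count-cong {p = Y} {q = Z} Y≗Z) Y≤ ,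
      ≤-<-trans (count-mono {p = seen X Z} {q = seen X Y} λ y e →
          let o , nb = ∧-elim {U y ∧ not (covers X y)} e
          in ∧-intro o (any∧-mono {Z} {Y} (λ p → Γ p y) (λ p Zp → trans (Y≗Z p) Zp) nb))
        (subst (λ c → count (seen X Y) < D * c) (count-cong {p = Y} {q = Z} Y≗Z) sparse)

  -- A maximal set X with few neighbours in U outside its own vertices has fewer than s
  -- elements; beyond its vertices no set is sparse any more.
  prune-from : ∀ f X → s ≤ f + count X → count X < s → count (seen X X) ≤ D * count X → ∃ Pruned
  prune-from zero    X s≤ X<s _ = ⊥-elim (<-irrefl refl (<-≤-trans X<s s≤))
  prune-from (suc f) X s≤ X<s tX with sparse? X
  ... | no none = (λ v → not (covers X v)) , many , λ Y Y⊆ Y≤ → ≮⇒≥ λ lt → none (Y , Y⊆ , Y≤ , lt)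
    where
    open ≤-Reasoning
    many : n ≤ count (λ v → not (covers X v)) + s
    many = begin
      n     ≡⟨ sym (count-all {n} {λ _ → true} (λ _ → refl)) ⟩
      count {n} (λ _ → true)
            ≤⟨ count-cover {p = λ _ → true} {q = λ v → not (covers X v)} {r = covers X}
                 (λ v _ → case split (covers X v) of λ where
                   (inj₁ c) → inj₂ c
                   (inj₂ c) → inj₁ (not-intro c)) ⟩
      count (λ v → not (covers X v)) + count (covers X)
            ≤⟨ +-monoʳ-≤ _ (≤-trans (covers-≤ X) (<⇒≤ X<s)) ⟩
      count (λ v → not (covers X v)) + s ∎
  ... | yes (Y , outY , Y≤ , sparse) =
    prune-from f Z (≤-trans s≤ (≤-trans (≤-reflexive (sym (+-suc f _))) (+-monoʳ-≤ f grows))) Z<s tZ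
    where
    open ≤-Reasoning
    Z : Fin N → Bool
    Z p = X p ∨ Y p
    disjoint : count X + count Y ≤ count Z
    disjoint = count-disjoint {p = Z} {q = X} {r = Y} (λ _ → ∨-introˡ) (λ p → ∨-introʳ {X p})
      λ p Xp → ¬-not λ Yp → true≢false (covers-intro X p Xp) (not-elim (outY p Yp))
    Y≥1 : 1 ≤ count Y
    Y≥1 = n≢0⇒n>0 λ e → case subst (λ c → count (seen X Y) < c) (trans (cong (D *_) e) (*-zeroʳ D)) sparse of λ ()
    grows : suc (count X) ≤ count Z
    grows = ≤-trans (≤-reflexive (+-comm 1 _)) (≤-trans (+-monoʳ-≤ (count X) Y≥1) disjoint)
    tZ : count (seen Z Z) ≤ D * count Z
    tZ = begin
      count (seen Z Z)
        ≤⟨ count-cover {p = seen Z Z} {q = seen X X} {r = seen X Y} (seen-∪ X Y) ⟩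
      count (seen X X) + count (seen X Y) ≤⟨ +-mono-≤ tX (<⇒≤ sparse) ⟩
      D * count X + D * count Y           ≡⟨ sym (*-distribˡ-+ D (count X) (count Y)) ⟩
      D * (count X + count Y)             ≤⟨ *-monoʳ-≤ D disjoint ⟩
      D * count Z                         ∎
    Z<s : count Z < s
    Z<s = sparse-small Z (begin
      count Z             ≤⟨ count-cover {p = Z} {q = X} {r = Y} (λ p → ∨-elim) ⟩
      count X + count Y   ≤⟨ +-mono-≤ (<⇒≤ X<s) Y≤ ⟩
      s + 2 * s           ∎) tZ

  prune : 1 ≤ s → ∃ Pruned
  prune 1≤s = prune-from s (λ _ → false) (m≤m+n s _)
    (≤-trans (s≤s (≤-reflexive (count-none {N} (λ _ → refl)))) 1≤s)
    (≤-trans (≤-reflexive (count-none {p = seen ∅ ∅} λ y → ¬-not λ e →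
      case anyF-elim {p = λ p → false ∧ Γ p y} (proj₂ (∧-elim {U y ∧ not (covers ∅ y)} e)) of λ ())) z≤n)
    where
    ∅ : Fin N → Bool
    ∅ _ = false

-- Growing trees

module Growth {N n t : ℕ} (q s : ℕ) (2≤q : 2 ≤ q) (1≤s : 1 ≤ s) (Γ : Fin N → Fin n → Bool)
              (V′ A : Fin n → Bool) (A⊆V′ : ∀ y → A y ≡ true → V′ y ≡ true)
              (π : Fin N → Fin n) (pair : Fin n → Fin t → Fin N)
              (π-pair : ∀ w c → π (pair w c) ≡ w) (joined : Joined s Γ) where

  ok : Fin N → Bool
  ok p = V′ (π p)

  open Assignment (suc q) s Γ ok A joined public

  reserve : ℕ
  reserve = 2 * s * suc q + s

  record Fine (σ : Asg) : Set where
    field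
      expands : Expands σ
      valid   : Valid σ
      closed  : ∀ {y p} → σ y ≡ just p → free σ (π p) ≡ false
  open Fine

  fine-assign : ∀ {σ y p} → Fine σ → free σ y ≡ true → Γ p y ≡ true → free σ (π p) ≡ false →
                Expands (assign σ y p) → Fine (assign σ y p)
  fine-assign {σ} {y} {p} fσ fy Γpy occ e = record
    { expands = e
    ; valid   = valid-assign (valid fσ) (proj₁ (∧-elim {A y} fy)) Γpy
    ; closed  = λ {z} {r} eq → occupied-⊑ {σ} {assign σ y p} (⊑-assign σ p fy) (case assign-inv σ y p eq of λ where
        (inj₁ (_ , refl)) → occ
        (inj₂ e′)         → closed fσ e′)
    }

  abstract
    step : ∀ {σ p} → Fine σ → reserve ≤ count (free σ) → ok p ≡ true → free σ (π p) ≡ false →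
           load σ p < suc q → ∃ λ y → free σ y ≡ true × Γ p y ≡ true × Fine (assign σ y p)
    step fσ room okp occ load< with extend 1≤s (expands fσ) room okp load<
    ... | y , fy , Γpy , e = y , fy , Γpy , fine-assign fσ fy Γpy occ e

  load-assign : ∀ σ {y} p r → load (assign σ y p) r ≤ 𝟙 (p == r) + load σ r
  load-assign σ {y} p r with p F.≟ r
  ... | yes refl = count-off {p = λ z → names (assign σ y p z) p} {q = λ z → names (σ z) p} y
        λ z z≢y e → subst (λ a → names a p ≡ true) (upd-other σ y (just p) (z≢y ∘ sym)) e
  ... | no p≢r = count-mono {p = λ z → names (assign σ y p z) r} {q = λ z → names (σ z) r} λ z e →
        case assign-inv σ y p (names-sound (assign σ y p z) e) of λ where
          (inj₁ (_ , p≡r)) → contradiction p≡r p≢r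
          (inj₂ e′)        → names-just e′

  record Level (σ : Asg) (ws : List (Fin n)) (c : Fin t) : Set where
    field
      {τ}     : Asg
      new     : List (Fin n)
      fine    : Fine τ
      σ⊑τ     : σ ⊑ τ
      length≡ : length new ≡ length ws
      unique  : Unique new
      fresh   : All (λ y → free σ y ≡ true × ∃ λ w → w ∈ ws × τ y ≡ just (pair w c)) new
      sources : ∀ y p → τ y ≡ just p → σ y ≡ just p ⊎ π p ∈ ws
      room    : count (free σ) ≤ count (free τ) + length ws

  pair-== : ∀ w w′ c → 𝟙 (pair w c == pair w′ c) ≤ 𝟙 (w == w′)
  pair-== w w′ c = 𝟙-mono λ e →
    ==-complete (trans (sym (π-pair w c)) (trans (cong π (==-sound e)) (π-pair w′ c)))

  abstract
    growLevel : ∀ σ ws c → Fine σ → reserve + length ws ≤ count (free σ) →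
                All (λ w → V′ w ≡ true × free σ w ≡ false) ws →
                (∀ w → w ∈ ws → load σ (pair w c) + mult w ws ≤ suc q) → Level σ ws c
    growLevel σ [] c fσ room _ _ = record
      { new = [] ; fine = fσ ; σ⊑τ = ⊑-refl {σ} ; length≡ = refl ; unique = [] ; fresh = []
      ; sources = λ _ _ → inj₁ ; room = ≤-reflexive (sym (+-identityʳ _)) }
    growLevel σ (w ∷ ws) c fσ room ((Vw , occ) ∷ occs) loads
      with step {p = pair w c} fσ (≤-trans (m≤m+n reserve _) room)
             (trans (cong V′ (π-pair w c)) Vw) (trans (cong (free σ) (π-pair w c)) occ)
             (≤-trans (≤-reflexive (+-comm 1 _)) (≤-trans (+-monoʳ-≤ (load σ (pair w c))
               (≤-trans (≤-reflexive (sym (cong 𝟙 (==-refl w)))) (m≤m+n _ (mult w ws)))) (loads w (here refl))))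
    ... | y , fy , Γpy , fσ₁ = record
      { new     = y ∷ L.new
      ; fine    = L.fine
      ; σ⊑τ     = ⊑-trans {σ} {σ₁} {L.τ} σ⊑σ₁ L.σ⊑τ
      ; length≡ = cong suc L.length≡
      ; unique  = All.map (λ { (fz , _) refl → true≢false fz (assigned-occupied σ₁ σ₁y) }) L.fresh ∷ L.unique
      ; fresh   = (fy , w , here refl , ⊑-just {σ₁} {L.τ} L.σ⊑τ σ₁y)
                  ∷ All.map (λ (fz , v , v∈ , e) → free-⊑ {σ} {σ₁} σ⊑σ₁ fz , v , there v∈ , e) L.fresh
      ; sources = λ z p e → case L.sources z p e of λ where
          (inj₂ i) → inj₂ (there i)
          (inj₁ e′) → case assign-inv σ y (pair w c) e′ of λ where
            (inj₁ (_ , refl)) → inj₂ (here (π-pair w c))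
            (inj₂ e″)         → inj₁ e″
      ; room    = ≤-trans (free-assign σ y (pair w c))
                    (≤-trans (s≤s L.room) (≤-reflexive (sym (+-suc (count (free L.τ)) (length ws)))))
      }
      where
      σ₁ : Asg
      σ₁ = assign σ y (pair w c)
      σ⊑σ₁ : σ ⊑ σ₁
      σ⊑σ₁ = ⊑-assign σ (pair w c) fy
      σ₁y : σ₁ y ≡ just (pair w c)
      σ₁y = upd-same σ y (just (pair w c))
      loads₁ : ∀ v → v ∈ ws → load σ₁ (pair v c) + mult v ws ≤ suc q
      loads₁ v v∈ = begin
        load σ₁ (pair v c) + mult v ws
          ≤⟨ +-monoˡ-≤ _ (≤-trans (load-assign σ {y} (pair w c) (pair v c)) (+-monoˡ-≤ _ (pair-== w v c))) ⟩
        (𝟙 (w == v) + load σ (pair v c)) + mult v ws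
          ≡⟨ cong (_+ mult v ws) (+-comm (𝟙 (w == v)) _) ⟩
        (load σ (pair v c) + 𝟙 (w == v)) + mult v ws
          ≡⟨ +-assoc (load σ (pair v c)) _ _ ⟩
        load σ (pair v c) + mult v (w ∷ ws)
          ≤⟨ loads v (there v∈) ⟩
        suc q ∎
        where open ≤-Reasoning
      module L = Level (growLevel σ₁ ws c fσ₁
        (≤-pred (≤-trans (≤-reflexive (sym (+-suc reserve _))) (≤-trans room (free-assign σ y (pair w c)))))
        (All.map (λ (Vv , o) → Vv , occupied-⊑ {σ} {σ₁} σ⊑σ₁ o) occs) loads₁)

  module Trees {m : ℕ} (col : Fin m → Fin m → Fin t) where

    -- The guest path x ∷ xs ++ [ a ], listed from its far end, is mapped along a host path from
    -- α to y.  Each vertex was still free in the assignment at the time its predecessor's branch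
    -- was complete; this makes the host path injective.
    data Branch (σ₀ : Asg) (a : Fin m) (α : Fin n) : Asg → List (Fin m) → Fin n → Set where
      root : ∀ {σ} → σ₀ ⊑ σ → Branch σ₀ a α σ [] α
      grow : ∀ {σ₁ σ xs w y} x → Branch σ₀ a α σ₁ xs w → free σ₁ y ≡ true → σ₁ ⊑ σ →
             σ y ≡ just (pair w (col (firstOr xs a) x)) → Branch σ₀ a α σ (x ∷ xs) y

    record Tree (σ : Asg) (a : Fin m) (α : Fin n) (xs : List (Fin m)) (k : ℕ) : Set where
      field
        {τ}      : Asg
        leaves   : List (Fin n)
        fine     : Fine τ
        σ⊑τ      : σ ⊑ τ
        size     : length leaves ≡ k
        unique   : Unique leaves
        branches : All (λ w → (V′ w ≡ true × free τ w ≡ false) × free σ w ≡ true × Branch σ a α τ xs w) leaves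
        unloaded : ∀ {w} → w ∈ leaves → ∀ c → load τ (pair w c) ≡ 0
        sources  : ∀ y p → τ y ≡ just p → σ y ≡ just p ⊎ π p ≡ α ⊎ free σ (π p) ≡ true
        room     : count (free σ) ≤ count (free τ) + 2 * k

    level⇒unloaded : ∀ {σ ws c} → Fine σ → All (λ w → V′ w ≡ true × free σ w ≡ false) ws →
                     (L : Level σ ws c) → ∀ {y} → y ∈ Level.new L → ∀ c′ → load (Level.τ L) (pair y c′) ≡ 0
    level⇒unloaded {σ} {ws} fσ occs L {y} y∈ c′ = count-none {p = λ z → names (L.τ z) (pair y c′)} λ z → ¬-not λ e →
      true≢false fy (case L.sources z (pair y c′) (names-sound (L.τ z) e) of λ where
        (inj₁ e′) → subst (λ v → free σ v ≡ false) (π-pair y c′) (closed fσ e′)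
        (inj₂ i)  → proj₂ (All.lookup occs (subst (_∈ ws) (π-pair y c′) i)))
      where
      module L = Level L
      fy : free σ y ≡ true
      fy = proj₁ (All.lookup L.fresh y∈)

    abstract
      growTree : ∀ σ a α x xs → Fine σ → V′ α ≡ true → free σ α ≡ false →
                 load σ (pair α (col a (lastOf x xs))) < suc q →
                 reserve + 2 * q ^ length xs ≤ count (free σ) → Tree σ a α (x ∷ xs) (q ^ length xs)
      growTree σ a α x [] fσ Vα occ load< room = record
        { leaves   = L.new
        ; fine     = L.fine
        ; σ⊑τ      = L.σ⊑τ
        ; size     = L.length≡
        ; unique   = L.unique
        ; branches = All.map (λ { (fy , w , here refl , e) →
            (A⊆V′ _ (proj₁ (∧-elim fy)) , assigned-occupied L.τ e) , fy ,
            grow x (root (⊑-refl {σ})) fy L.σ⊑τ e }) L.fresh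
        ; unloaded = level⇒unloaded fσ occs L
        ; sources  = λ y p e → case L.sources y p e of λ where
            (inj₁ e′)       → inj₁ e′
            (inj₂ (here e′)) → inj₂ (inj₁ e′)
        ; room     = ≤-trans L.room (+-monoʳ-≤ _ (s≤s z≤n))
        }
        where
        occs : All (λ w → V′ w ≡ true × free σ w ≡ false) (α ∷ [])
        occs = (Vα , occ) ∷ []
        L : Level σ (α ∷ []) (col a x)
        L = growLevel σ (α ∷ []) (col a x) fσ (≤-trans (+-monoʳ-≤ reserve (s≤s z≤n)) room) occs
          λ { w (here refl) → subst (λ b → load σ (pair α (col a x)) + (𝟙 b + 0) ≤ suc q) (sym (==-refl α))
                (≤-trans (≤-reflexive (+-comm _ 1)) load<) }
        module L = Level L
      growTree σ a α x (x′ ∷ xs) fσ Vα occ load< room = record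
        { leaves   = L.new
        ; fine     = L.fine
        ; σ⊑τ      = ⊑-trans {σ} {T.τ} {L.τ} T.σ⊑τ L.σ⊑τ
        ; size     = trans L.length≡ length-jobs
        ; unique   = L.unique
        ; branches = All.map (λ (fy , w , w∈ , e) →
            (A⊆V′ _ (proj₁ (∧-elim fy)) , assigned-occupied L.τ e) , free-⊑ {σ} {T.τ} T.σ⊑τ fy ,
            grow x (proj₂ (proj₂ (All.lookup T.branches (∈-dup q T.leaves w∈)))) fy L.σ⊑τ e) L.fresh
        ; unloaded = level⇒unloaded T.fine occs L
        ; sources  = λ y p e → case L.sources y p e of λ where
            (inj₁ e′) → T.sources y p e′
            (inj₂ i)  → inj₂ (inj₂ (proj₁ (proj₂ (All.lookup T.branches (∈-dup q T.leaves i)))))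
        ; room     = total
        }
        where
        open ≤-Reasoning
        k : ℕ
        k = q ^ length xs
        2k≤qk : 2 * k ≤ q * k
        2k≤qk = *-monoˡ-≤ k 2≤q
        T : Tree σ a α (x′ ∷ xs) k
        T = growTree σ a α x′ xs fσ Vα occ load<
          (≤-trans (+-monoʳ-≤ reserve (≤-trans 2k≤qk (m≤m+n (q * k) _))) room)
        module T = Tree T
        jobs : List (Fin n)
        jobs = dup q T.leaves
        length-jobs : length jobs ≡ q * k
        length-jobs = trans (length-dup q T.leaves) (cong (q *_) T.size)
        occs : All (λ w → V′ w ≡ true × free T.τ w ≡ false) jobs
        occs = All.tabulate λ i → proj₁ (All.lookup T.branches (∈-dup q T.leaves i))
        L : Level T.τ jobs (col x′ x)
        L = growLevel T.τ jobs (col x′ x) T.fine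
          (+-cancelʳ-≤ (q * k) _ _ (begin
            (reserve + length jobs) + q * k ≡⟨ cong (λ z → (reserve + z) + q * k) length-jobs ⟩
            (reserve + q * k) + q * k       ≡⟨ trans (+-assoc reserve _ _) (cong (λ z → reserve + (q * k + z)) (sym (+-identityʳ (q * k)))) ⟩
            reserve + 2 * (q * k)           ≤⟨ room ⟩
            count (free σ)                  ≤⟨ T.room ⟩
            count (free T.τ) + 2 * k        ≤⟨ +-monoʳ-≤ _ 2k≤qk ⟩
            count (free T.τ) + q * k        ∎))
          occs
          λ w w∈ → ≤-trans (≤-reflexive (cong (_+ mult w jobs) (T.unloaded (∈-dup q T.leaves w∈) (col x′ x))))
            (≤-trans (mult-dup w q T.leaves T.unique) (n≤1+n q))
        module L = Level L
        total : count (free σ) ≤ count (free L.τ) + 2 * (q * k)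
        total = begin
          count (free σ)                                 ≤⟨ T.room ⟩
          count (free T.τ) + 2 * k                       ≤⟨ +-mono-≤ L.room 2k≤qk ⟩
          (count (free L.τ) + length jobs) + q * k       ≡⟨ cong (λ z → (count (free L.τ) + z) + q * k) length-jobs ⟩
          (count (free L.τ) + q * k) + q * k             ≡⟨ trans (+-assoc (count (free L.τ)) _ _) (cong (λ z → count (free L.τ) + (q * k + z)) (sym (+-identityʳ (q * k)))) ⟩
          count (free L.τ) + 2 * (q * k)                 ∎

-- Embedding the guest graph

edgesOf : ∀ {n t} → Family n t → Fin (n * t) → Fin n → Bool
edgesOf {n} {t} G p y = G (F.remainder {n} t p) (F.quotient t p) y

module _ {n t : ℕ} where

  quotient-combine : ∀ (w : Fin n) (c : Fin t) → F.quotient t (F.combine w c) ≡ w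
  quotient-combine w c = cong proj₁ (F.remQuot-combine w c)

  edgesOf-combine : ∀ (G : Family n t) w c y → edgesOf G (F.combine w c) y ≡ G c w y
  edgesOf-combine G w c y = cong (λ (v , i) → G i v y) (F.remQuot-combine w c)

  joined-edgesOf : ∀ {s} (G : Family n t) → SJoined s G → Joined s (edgesOf G)
  joined-edgesOf G joined X Y sX sY
    with joined (λ v i → X (F.combine v i)) Y (≤-trans sX (≤-reflexive (sumF-combine n t (𝟙 ∘ X)))) sY
  ... | u , i , v , Xui , Yv , uv = F.combine u i , v , Xui , Yv , trans (edgesOf-combine G u i v) uv

module Embedding {N n t m : ℕ} (q s : ℕ) (2≤q : 2 ≤ q) (1≤s : 1 ≤ s)
  (G : Family n t) (G-simple : ∀ i → IsSimple (G i))
  (π : Fin N → Fin n) (pair : Fin n → Fin t → Fin N) (Γ : Fin N → Fin n → Bool)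
  (π-pair : ∀ w c → π (pair w c) ≡ w)
  (pair-injective : ∀ w c w′ c′ → pair w c ≡ pair w′ c′ → w ≡ w′ × c ≡ c′)
  (Γ-pair : ∀ w c y → Γ (pair w c) y ≡ G c w y) (joined : Joined s Γ)
  (V′ A : Fin n → Bool) (A⊆V′ : ∀ y → A y ≡ true → V′ y ≡ true)
  (largeV′ : n ≤ count V′ + s) (m≤n : m + 6 * s * suc q ≤ n)
  (H : Graph m) (H-simple : IsSimple H)
  (col : Fin m → Fin m → Fin t) (col-sym : IsColouring H col) (degree : MonDegLe H col (suc q))
  where

  open Growth {N} {n} {t} q s 2≤q 1≤s Γ V′ A A⊆V′ π pair π-pair joined public
  open Trees col public

  Emb : (Fin m → Fin n) → Fin m → Fin m → Set
  Emb φ u v = Adj H u v × Adj (G (col u v)) (φ u) (φ v)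

  Adj-sym : ∀ {u v} → Adj H u v → Adj H v u
  Adj-sym {u} {v} e = trans (sym (proj₁ H-simple u v)) e

  Emb-sym : ∀ {φ u v} → Emb φ u v → Emb φ v u
  Emb-sym {φ} {u} {v} (uv , e) =
    Adj-sym uv ,
    trans (cong (λ c → G c (φ v) (φ u)) (sym (col-sym u v uv)))
      (trans (proj₁ (G-simple (col u v)) (φ v) (φ u)) e)

  Emb-≡ : ∀ {φ φ′ u v} → φ′ u ≡ φ u → φ′ v ≡ φ v → Emb φ u v → Emb φ′ u v
  Emb-≡ {u = u} {v} eu ev (uv , e) = uv , trans (cong₂ (G (col u v)) eu ev) e

  -- Dom is the set of embedded guest vertices; the roots are the occupied host vertices
  -- that are not assigned.
  record Embedded (Dom : Fin m → Bool) (φ : Fin m → Fin n) (σ : Asg) : Set where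
    field
      fine     : Fine σ
      inj      : ∀ {x y} → Dom x ≡ true → Dom y ≡ true → φ x ≡ φ y → x ≡ y
      inV′     : ∀ {x} → Dom x ≡ true → V′ (φ x) ≡ true
      occupied : ∀ {x} → Dom x ≡ true → free σ (φ x) ≡ false
      onto     : ∀ y → V′ y ≡ true → free σ y ≡ false → ∃ λ x → Dom x ≡ true × φ x ≡ y
      served   : ∀ y p → σ y ≡ just p → ∃₂ λ x z →
                 (Dom x ≡ true × Dom z ≡ true) × φ z ≡ y × p ≡ pair (φ x) (col x z) × Adj H x z
  open Embedded

  insert : (Fin m → Bool) → Fin m → Fin m → Bool
  insert Dom z = upd Dom z true

  insert-new : ∀ Dom z → insert Dom z z ≡ true
  insert-new Dom z = upd-same Dom z true

  insert-old : ∀ Dom z {u} → Dom u ≡ true → insert Dom z u ≡ true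
  insert-old Dom z {u} Du with z F.≟ u
  ... | yes _ = refl
  ... | no  _ = Du

  insert-inv : ∀ Dom z {u} → insert Dom z u ≡ true → z ≡ u ⊎ Dom u ≡ true
  insert-inv Dom z {u} e with z F.≟ u
  ... | yes z≡u = inj₁ z≡u
  ... | no  _   = inj₂ e

  upd-agree : ∀ {Dom : Fin m → Bool} {z u} (φ : Fin m → Fin n) y →
              Dom z ≡ false → Dom u ≡ true → upd φ z y u ≡ φ u
  upd-agree φ y ¬Dz Du = upd-other φ _ y λ { refl → true≢false Du ¬Dz }

  abstract
    addVertex : ∀ {Dom φ σ x z y} → Embedded Dom φ σ → Dom x ≡ true → Dom z ≡ false → Adj H x z →
                free σ y ≡ true → Γ (pair (φ x) (col x z)) y ≡ true →
                Expands (assign σ y (pair (φ x) (col x z))) →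
                Embedded (insert Dom z) (upd φ z y) (assign σ y (pair (φ x) (col x z))) ×
                Emb (upd φ z y) x z
    addVertex {Dom} {φ} {σ} {x} {z} {y} E Dx ¬Dz xz fy Γpy ex = E′ ,
      (xz , trans (cong₂ (G (col x z)) (agree Dx) (upd-same φ z y)) (trans (sym (Γ-pair _ _ _)) Γpy))
      where
      p : Fin N
      p = pair (φ x) (col x z)
      σ′ : Asg
      σ′ = assign σ y p
      φ′ : Fin m → Fin n
      φ′ = upd φ z y
      φ′z : φ′ z ≡ y
      φ′z = upd-same φ z y
      σ′y : σ′ y ≡ just p
      σ′y = upd-same σ y (just p)
      agree : ∀ {u} → Dom u ≡ true → φ′ u ≡ φ u
      agree = upd-agree φ y ¬Dz
      y≢ : ∀ {u} → Dom u ≡ true → y ≢ φ u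
      y≢ Du refl = true≢false fy (occupied E Du)
      E′ : Embedded (insert Dom z) φ′ σ′
      E′ .fine = fine-assign (fine E) fy Γpy
        (trans (cong (free σ) (π-pair (φ x) (col x z))) (occupied E Dx)) ex
      E′ .inj {u} {v} Du Dv e with insert-inv Dom z Du | insert-inv Dom z Dv
      ... | inj₁ refl | inj₁ refl = refl
      ... | inj₁ refl | inj₂ Dv′  = ⊥-elim (y≢ Dv′ (trans (sym φ′z) (trans e (agree Dv′))))
      ... | inj₂ Du′  | inj₁ refl = ⊥-elim (y≢ Du′ (trans (sym φ′z) (trans (sym e) (agree Du′))))
      ... | inj₂ Du′  | inj₂ Dv′  = inj E Du′ Dv′ (trans (sym (agree Du′)) (trans e (agree Dv′)))
      E′ .inV′ Du with insert-inv Dom z Du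
      ... | inj₁ refl = trans (cong V′ φ′z) (A⊆V′ y (proj₁ (∧-elim {A y} fy)))
      ... | inj₂ Du′  = trans (cong V′ (agree Du′)) (inV′ E Du′)
      E′ .occupied Du with insert-inv Dom z Du
      ... | inj₁ refl = trans (cong (free σ′) φ′z) (assigned-occupied σ′ σ′y)
      ... | inj₂ Du′  = trans (cong (free σ′) (agree Du′))
                          (occupied-⊑ {σ} {σ′} (⊑-assign σ p fy) (occupied E Du′))
      E′ .onto w Vw occ with y F.≟ w
      ... | yes refl = z , insert-new Dom z , φ′z
      ... | no  y≢w with onto E w Vw occ
      ... | u , Du , φu = u , insert-old Dom z Du , trans (agree Du) φu
      E′ .served w r e with assign-inv σ y p e
      ... | inj₁ (refl , refl) = x , z , (insert-old Dom z Dx , insert-new Dom z) , φ′z ,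
                                 cong (λ v → pair v (col x z)) (sym (agree Dx)) , xz
      ... | inj₂ e′ with served E w r e′
      ... | u , v , (Du , Dv) , φv , eq , uv =
        u , v , (insert-old Dom z Du , insert-old Dom z Dv) , trans (agree Dv) φv ,
        trans eq (cong (λ v′ → pair v′ (col u v)) (sym (agree Du))) , uv

  abstract
    load-bound : ∀ {Dom φ σ x z} → Embedded Dom φ σ → Dom x ≡ true → Dom z ≡ false → Adj H x z →
                 load σ (pair (φ x) (col x z)) < suc q
    load-bound {Dom} {φ} {σ} {x} {z} E Dx ¬Dz xz = <-≤-trans (≤-<-trans
        (count-image {p = λ y → names (σ y) p} {q = embeddedNbr} φ image)
        (count-strict {p = embeddedNbr} {q = λ u → H x u ∧ (col x u == col x z)} z
          (λ u e → proj₂ (∧-elim {Dom u} e)) (cong (_∧ _) ¬Dz) (∧-intro xz (==-refl (col x z)))))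
      (degree (col x z) x)
      where
      p : Fin N
      p = pair (φ x) (col x z)
      embeddedNbr : Fin m → Bool
      embeddedNbr u = Dom u ∧ (H x u ∧ (col x u == col x z))
      image : ∀ y → names (σ y) p ≡ true → ∃ λ u → embeddedNbr u ≡ true × φ u ≡ y
      image y e with served E y p (names-sound (σ y) e)
      ... | x′ , u , (Dx′ , Du) , φu , eq , x′u
        with pair-injective (φ x) (col x z) (φ x′) (col x′ u) eq
      ... | φx≡φx′ , same with inj E Dx Dx′ φx≡φx′
      ... | refl = u , ∧-intro Du (∧-intro x′u (==-complete (sym same))) , φu

  room : ∀ {Dom φ σ} → Embedded Dom φ σ → 6 * s * suc q ≤ count (free σ) + s
  room {Dom} {φ} {σ} E = +-cancelˡ-≤ m _ _ (begin
    m + 6 * s * suc q                    ≤⟨ m≤n ⟩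
    n                                    ≤⟨ largeV′ ⟩
    count V′ + s                         ≤⟨ +-monoˡ-≤ s (count-cover {p = V′} {q = free σ} {r = taken} classify) ⟩
    (count (free σ) + count taken) + s   ≤⟨ +-monoˡ-≤ s (+-monoʳ-≤ _ taken≤m) ⟩
    (count (free σ) + m) + s             ≡⟨ cong (_+ s) (+-comm _ m) ⟩
    (m + count (free σ)) + s             ≡⟨ +-assoc m _ s ⟩
    m + (count (free σ) + s)             ∎)
    where
    open ≤-Reasoning
    taken : Fin n → Bool
    taken y = V′ y ∧ not (free σ y)
    classify : ∀ y → V′ y ≡ true → free σ y ≡ true ⊎ taken y ≡ true
    classify y Vy with split (free σ y)
    ... | inj₁ fy = inj₁ fy
    ... | inj₂ fy = inj₂ (∧-intro Vy (not-intro fy))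
    taken≤m : count taken ≤ m
    taken≤m = ≤-trans
      (count-image {p = taken} {q = λ (_ : Fin m) → true} φ λ y e →
        let Vy , nf = ∧-elim {V′ y} e
            x , _ , φx = onto E y Vy (not-elim nf)
        in x , refl , φx)
      (≤-reflexive (count-all {m} {λ _ → true} (λ _ → refl)))

  abstract
    reserve-room : ∀ {Dom φ σ} → Embedded Dom φ σ → reserve + 4 * (q * s) ≤ count (free σ)
    reserve-room E = +-cancelʳ-≤ s _ _ (≤-trans
      (≤-trans (m≤m+n _ (2 * s))
        (≤-reflexive (solve 2 (λ q s →
           ((con 2 :* s :* (con 1 :+ q) :+ s :+ con 4 :* (q :* s)) :+ s) :+ con 2 :* s
             := con 6 :* s :* (con 1 :+ q)) refl q s)))
      (room E))
      where open +-*-Solver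

  record Outcome (Dom : Fin m → Bool) (φ : Fin m → Fin n) (p : List (Fin m)) : Set where
    field
      {Dom′}   : Fin m → Bool
      {φ′}     : Fin m → Fin n
      {σ′}     : Asg
      embedded : Embedded Dom′ φ′ σ′
      grows    : ∀ {x} → Dom x ≡ true → Dom′ x ≡ true
      agree    : ∀ {x} → Dom x ≡ true → φ′ x ≡ φ x
      onlyIn   : ∀ {x} → Dom′ x ≡ true → Dom x ≡ true ⊎ x ∈ p
      allIn    : All (λ x → Dom′ x ≡ true) p
      linked   : Linked (Emb φ′) p

  abstract
    leaf : ∀ {Dom φ σ x z} → Embedded Dom φ σ → Dom x ≡ true → Dom z ≡ false → Adj H x z →
           ∃₂ λ y σ′ → Embedded (insert Dom z) (upd φ z y) σ′ × Emb (upd φ z y) x z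
    leaf {φ = φ} {σ} {x} {z} E Dx ¬Dz xz
      with step {p = pair (φ x) (col x z)} (fine E) (≤-trans (m≤m+n reserve _) (reserve-room E))
             (trans (cong V′ (π-pair (φ x) (col x z))) (inV′ E Dx))
             (trans (cong (free σ) (π-pair (φ x) (col x z))) (occupied E Dx))
             (load-bound E Dx ¬Dz xz)
    ... | y , fy , Γpy , fσ′ = y , _ , addVertex E Dx ¬Dz xz fy Γpy (Fine.expands fσ′)

  prepend : ∀ {Dom φ a z y zs} → Dom a ≡ true → Dom z ≡ false → Emb (upd φ z y) a z →
            Outcome (insert Dom z) (upd φ z y) (z ∷ zs) → Outcome Dom φ (a ∷ z ∷ zs)
  prepend {Dom} {φ} {a} {z} {y} Da ¬Dz az O = record
    { embedded = O.embedded
    ; grows    = O.grows ∘ insert-old Dom z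
    ; agree    = λ Dx → trans (O.agree (insert-old Dom z Dx)) (upd-agree φ y ¬Dz Dx)
    ; onlyIn   = λ D′x → case O.onlyIn D′x of λ where
        (inj₂ x∈) → inj₂ (there x∈)
        (inj₁ Dx) → case insert-inv Dom z Dx of λ where
          (inj₁ refl) → inj₂ (there (here refl))
          (inj₂ Dx′)  → inj₁ Dx′
    ; allIn    = O.grows (insert-old Dom z Da) ∷ O.allIn
    ; linked   = Emb-≡ (O.agree (insert-old Dom z Da)) (O.agree (insert-new Dom z)) az ∷ O.linked
    }
    where module O = Outcome O

  outside-insert : ∀ {Dom z zs} → All (z ≢_) zs → All (λ x → Dom x ≡ false) zs →
                   All (λ x → insert Dom z x ≡ false) zs
  outside-insert {Dom} {z} z∉ out =
    All.zipWith (λ (z≢x , ¬Dx) → trans (upd-other Dom z true z≢x) ¬Dx) (z∉ , out)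

  trivialOutcome : ∀ {Dom φ σ a} → Embedded Dom φ σ → Dom a ≡ true → Outcome Dom φ [ a ]
  trivialOutcome E Da = record
    { embedded = E ; grows = λ Dx → Dx ; agree = λ _ → refl ; onlyIn = inj₁ ; allIn = Da ∷ [] ; linked = [-] }

  addPendantPath : ∀ {Dom φ σ} a zs → Embedded Dom φ σ → Dom a ≡ true →
                   All (λ x → Dom x ≡ false) zs → Unique zs → Linked (Adj H) (a ∷ zs) →
                   Outcome Dom φ (a ∷ zs)
  addPendantPath a []       E Da _            _          _        = trivialOutcome E Da
  addPendantPath {Dom} a (z ∷ zs) E Da (¬Dz ∷ out) (z∉ ∷ uq) (az ∷ l) with leaf E Da ¬Dz az
  ... | y , σ′ , E′ , emb =
    prepend Da ¬Dz emb (addPendantPath z zs E′ (insert-new Dom z) (outside-insert z∉ out) uq l)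

  abstract
    follow : ∀ {Dom φ σ σ₀ τ a α xs w} → Embedded Dom φ σ → σ ⊑ σ₀ → Expands τ → Valid τ →
             α ≡ φ a → Branch σ₀ a α τ xs w → Dom a ≡ true →
             All (λ x → Dom x ≡ false) xs → Unique xs → Linked (Adj H) (xs ++ [ a ]) →
             Σ (Outcome Dom φ (xs ++ [ a ])) λ O →
               Outcome.σ′ O ⊑ τ × Outcome.φ′ O (firstOr xs a) ≡ w
    follow {σ = σ} {σ₀} {τ} E σσ₀ eτ vτ α≡ (root σ₀τ) Da _ _ _ =
      trivialOutcome E Da , ⊑-trans {σ} {σ₀} {τ} σσ₀ σ₀τ , sym α≡
    follow {Dom} {φ} {τ = τ} {a} {xs = x ∷ xs} {y} E σσ₀ eτ vτ α≡ (grow {σ₁ = σ₁} {w = w} x b fy σ₁τ τy)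
           Da (¬Dx ∷ out) (x∉ ∷ uq) l
      with follow E σσ₀ (good-⊑ vτ σ₁τ eτ) (valid-⊑ {σ₁} {τ} vτ σ₁τ) α≡ b Da out uq (Linked.tail l)
    ... | O , σ′σ₁ , φ′z = record
        { embedded = proj₁ added
        ; grows    = insert-old O.Dom′ x ∘ O.grows
        ; agree    = λ Du → trans (upd-agree O.φ′ y ¬D′x (O.grows Du)) (O.agree Du)
        ; onlyIn   = λ Du → case insert-inv O.Dom′ x Du of λ where
            (inj₁ refl) → inj₂ (here refl)
            (inj₂ Du′)  → case O.onlyIn Du′ of λ where
              (inj₁ Du″) → inj₁ Du″
              (inj₂ u∈)  → inj₂ (there u∈)
        ; allIn    = insert-new O.Dom′ x ∷ All.map (insert-old O.Dom′ x) O.allIn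
        ; linked   = linked-∷⁺ xs (Emb-sym {upd O.φ′ x y} (proj₂ added)) (linked-map
            (λ Du Dv → Emb-≡ (upd-agree O.φ′ y ¬D′x Du) (upd-agree O.φ′ y ¬D′x Dv)) O.allIn O.linked)
        } , σ″τ , upd-same O.φ′ x y
      where
      module O = Outcome O
      z : Fin m
      z = firstOr xs a
      ¬D′x : O.Dom′ x ≡ false
      ¬D′x = ¬-not λ D′x → case O.onlyIn D′x of λ where
        (inj₁ Dx) → true≢false Dx ¬Dx
        (inj₂ x∈) → case ∈-++⁻ xs x∈ of λ where
          (inj₁ x∈xs)       → All.lookup x∉ x∈xs refl
          (inj₂ (here refl)) → true≢false Da ¬Dx
      p : Fin N
      p = pair (O.φ′ z) (col z x)
      τy′ : τ y ≡ just p
      τy′ = trans τy (cong (λ v → just (pair v (col z x))) (sym φ′z))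
      σ′τ : O.σ′ ⊑ τ
      σ′τ = ⊑-trans {O.σ′} {σ₁} {τ} σ′σ₁ σ₁τ
      σ″τ : assign O.σ′ y p ⊑ τ
      σ″τ = assign-⊑ {O.σ′} {τ} σ′τ τy′
      added : Embedded (insert O.Dom′ x) (upd O.φ′ x y) (assign O.σ′ y p) × Emb (upd O.φ′ x y) z x
      added = addVertex O.embedded (all-firstOr xs O.allIn) ¬D′x (Adj-sym (linked-∷⁻ x xs l))
        (free-⊑ {O.σ′} {σ₁} σ′σ₁ fy) (proj₂ (vτ y p τy′)) (good-⊑ vτ σ″τ eτ)

  connectBranches : ∀ {Dom φ σ τᵃ τᵇ a b w v} x xs y ys → Embedded Dom φ σ → Dom a ≡ true → Dom b ≡ true →
                    All (λ u → Dom u ≡ false) ((x ∷ xs) ++ (y ∷ ys)) → Unique ((x ∷ xs) ++ (y ∷ ys)) →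
                    Linked (Adj H) ((x ∷ xs ++ [ a ]) ʳ++ (y ∷ ys ++ [ b ])) →
                    Fine τᵃ → Fine τᵇ → Branch σ a (φ a) τᵃ (x ∷ xs) w → Branch τᵃ b (φ b) τᵇ (y ∷ ys) v →
                    Adj (G (col x y)) w v → Outcome Dom φ ((x ∷ xs ++ [ a ]) ʳ++ (y ∷ ys ++ [ b ]))
  connectBranches {Dom} {φ} {σ} {τᵃ} {τᵇ} {a} {b} {w} {v} x xs y ys E Da Db out uq l fᵃ fᵇ bᵃ bᵇ wv = record
    { embedded = O₂.embedded
    ; grows    = λ Du → O₂.grows (O₁.grows Du)
    ; agree    = λ Du → trans (O₂.agree (O₁.grows Du)) (O₁.agree Du)
    ; onlyIn   = λ D₂u → case O₂.onlyIn D₂u of λ where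
        (inj₂ u∈) → inj₂ (∈-resp-↭ perm (∈-++⁺ʳ (x ∷ xs ++ [ a ]) u∈))
        (inj₁ D₁u) → case O₁.onlyIn D₁u of λ where
          (inj₁ Du) → inj₁ Du
          (inj₂ u∈) → inj₂ (∈-resp-↭ perm (∈-++⁺ˡ u∈))
    ; allIn    = All-resp-↭ perm (All.++⁺ (All.map O₂.grows O₁.allIn) O₂.allIn)
    ; linked   = linked-ʳ++ Emb-sym (xs ++ [ a ])
        (linked-map (λ Du Dv → Emb-≡ (O₂.agree Du) (O₂.agree Dv)) O₁.allIn O₁.linked)
        (xy-emb ∷ O₂.linked)
    }
    where
    lˣ : Linked (Adj H) (x ∷ y ∷ ys ++ [ b ])
    lˣ = proj₂ (linked-ʳ++⁻ Adj-sym (xs ++ [ a ]) l)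
    outʸ : All (λ u → Dom u ≡ false) (y ∷ ys)
    outʸ = All.++⁻ʳ (x ∷ xs) out
    uniqueˣʸ : Unique (x ∷ xs) × Unique (y ∷ ys) × (∀ {z} → z ∈ x ∷ xs → z ∈ y ∷ ys → ⊥)
    uniqueˣʸ = unique-++⁻ (x ∷ xs) uq
    F₁ : Σ (Outcome Dom φ (x ∷ xs ++ [ a ])) λ O → Outcome.σ′ O ⊑ τᵃ × Outcome.φ′ O x ≡ w
    F₁ = follow E (⊑-refl {σ}) (Fine.expands fᵃ) (Fine.valid fᵃ) refl bᵃ Da (All.++⁻ˡ (x ∷ xs) out)
      (proj₁ uniqueˣʸ) (proj₁ (linked-ʳ++⁻ Adj-sym (xs ++ [ a ]) l))
    module O₁ = Outcome (proj₁ F₁)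
    out₁ : ∀ {u} → u ∈ y ∷ ys → O₁.Dom′ u ≡ false
    out₁ u∈ = ¬-not λ D₁u → case O₁.onlyIn D₁u of λ where
      (inj₁ Du)  → true≢false Du (All.lookup outʸ u∈)
      (inj₂ u∈ˣ) → case ∈-++⁻ (x ∷ xs) u∈ˣ of λ where
        (inj₁ u∈xs)        → proj₂ (proj₂ uniqueˣʸ) u∈xs u∈
        (inj₂ (here refl)) → true≢false Da (All.lookup outʸ u∈)
    F₂ : Σ (Outcome O₁.Dom′ O₁.φ′ (y ∷ ys ++ [ b ])) λ O → Outcome.σ′ O ⊑ τᵇ × Outcome.φ′ O y ≡ v
    F₂ = follow O₁.embedded (proj₁ (proj₂ F₁)) (Fine.expands fᵇ) (Fine.valid fᵇ) (sym (O₁.agree Db)) bᵇ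
      (O₁.grows Db) (All.tabulate out₁) (proj₁ (proj₂ uniqueˣʸ)) (Linked.tail lˣ)
    module O₂ = Outcome (proj₁ F₂)
    perm : (x ∷ xs ++ [ a ]) ++ (y ∷ ys ++ [ b ]) ↭ (x ∷ xs ++ [ a ]) ʳ++ (y ∷ ys ++ [ b ])
    perm = ++↭ʳ++ (x ∷ xs ++ [ a ]) (y ∷ ys ++ [ b ])
    xy-emb : Emb O₂.φ′ x y
    xy-emb = Linked.head lˣ ,
      trans (cong₂ (G (col x y)) (trans (O₂.agree (All.head O₁.allIn)) (proj₂ (proj₂ F₁))) (proj₂ (proj₂ F₂))) wv

  module _ (c : ℕ) (s≤qᶜ : s ≤ q ^ c) (qᶜ≤qs : q ^ c ≤ q * s) where

    twoTrees-room : ∀ {Dom φ σ} → Embedded Dom φ σ → ∀ {i j} → i ≡ c → j ≡ c →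
                    reserve + (2 * q ^ i + 2 * q ^ j) ≤ count (free σ)
    twoTrees-room E refl refl = ≤-trans (+-monoʳ-≤ reserve
      (≤-trans (≤-reflexive (sym (*-distribʳ-+ (q ^ c) 2 2))) (*-monoʳ-≤ 4 qᶜ≤qs))) (reserve-room E)

    leaves-edge : ∀ {i j} → i ≡ c → j ≡ c → ∀ ws vs c′ → Unique ws → Unique vs →
                  length ws ≡ q ^ i → length vs ≡ q ^ j →
                  ∃₂ λ w v → w ∈ ws × v ∈ vs × Adj (G c′) w v
    leaves-edge refl refl ws vs c′ uws uvs lw lv =
      let p , v , p∈ , v∈ , Γpv = joined (elem sources) (elem vs) s≤sources s≤vs
          w , w∈ , p≡ = ∈-map⁻ (λ w → pair w c′) (elem-sound sources p∈)
      in w , v , w∈ , elem-sound vs v∈ ,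
         trans (sym (Γ-pair w c′ v)) (trans (cong (λ r → Γ r v) (sym p≡)) Γpv)
      where
      sources : List (Fin N)
      sources = map (λ w → pair w c′) ws
      s≤sources : s ≤ count (elem sources)
      s≤sources = ≤-trans s≤qᶜ (≤-trans (≤-reflexive (sym (trans (length-map (λ w → pair w c′) ws) lw)))
        (count-elem (Unique.map⁺ (λ {u} {v} e → proj₁ (pair-injective u c′ v c′ e)) uws)))
      s≤vs : s ≤ count (elem vs)
      s≤vs = ≤-trans s≤qᶜ (≤-trans (≤-reflexive (sym lv)) (count-elem uvs))

    join : ∀ {Dom φ σ a b} xs ys → Embedded Dom φ σ → Dom a ≡ true → Dom b ≡ true → a ≢ b →
           All (λ x → Dom x ≡ false) (xs ++ ys) → Unique (xs ++ ys) →
           length xs ≡ suc c → length ys ≡ suc c →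
           Linked (Adj H) ((xs ++ [ a ]) ʳ++ (ys ++ [ b ])) →
           Outcome Dom φ ((xs ++ [ a ]) ʳ++ (ys ++ [ b ]))
    join {Dom} {φ} {σ} {a} {b} (x ∷ xs) (y ∷ ys) E Da Db a≢b out uq lx ly l =
      let w , v , w∈ , v∈ , wv = leaves-edge |xs|≡c |ys|≡c Tᵃ.leaves Tᵇ.leaves (col x y)
                                   Tᵃ.unique Tᵇ.unique Tᵃ.size Tᵇ.size
      in connectBranches x xs y ys E Da Db out uq l Tᵃ.fine Tᵇ.fine
           (proj₂ (proj₂ (All.lookup Tᵃ.branches w∈))) (proj₂ (proj₂ (All.lookup Tᵇ.branches v∈))) wv
      where
      lᵃ : Linked (Adj H) (x ∷ xs ++ [ a ])
      lᵃ = proj₁ (linked-ʳ++⁻ Adj-sym (xs ++ [ a ]) l)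
      lᵇ : Linked (Adj H) (y ∷ ys ++ [ b ])
      lᵇ = Linked.tail (proj₂ (linked-ʳ++⁻ Adj-sym (xs ++ [ a ]) l))
      |xs|≡c : length xs ≡ c
      |xs|≡c = suc-injective lx
      |ys|≡c : length ys ≡ c
      |ys|≡c = suc-injective ly
      roomᵃ : reserve + (2 * q ^ length ys + 2 * q ^ length xs) ≤ count (free σ)
      roomᵃ = twoTrees-room E |ys|≡c |xs|≡c
      Tᵃ : Tree σ a (φ a) (x ∷ xs) (q ^ length xs)
      Tᵃ = growTree σ a (φ a) x xs (fine E) (inV′ E Da) (occupied E Da)
        (load-bound E Da (all-lastOf x xs (All.++⁻ˡ (x ∷ xs) out)) (Adj-sym (linked-lastOf x xs lᵃ)))
        (≤-trans (+-monoʳ-≤ reserve (m≤n+m (2 * q ^ length xs) (2 * q ^ length ys))) roomᵃ)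
      module Tᵃ = Tree Tᵃ
      loadᵇ : load Tᵃ.τ (pair (φ b) (col b (lastOf y ys))) < suc q
      loadᵇ = ≤-<-trans (count-mono {p = λ z → names (Tᵃ.τ z) p} {q = λ z → names (σ z) p} unaffected)
        (load-bound E Db (all-lastOf y ys (All.++⁻ʳ (x ∷ xs) out)) (Adj-sym (linked-lastOf y ys lᵇ)))
        where
        p : Fin N
        p = pair (φ b) (col b (lastOf y ys))
        πp : π p ≡ φ b
        πp = π-pair (φ b) (col b (lastOf y ys))
        unaffected : ∀ z → names (Tᵃ.τ z) p ≡ true → names (σ z) p ≡ true
        unaffected z e = case Tᵃ.sources z p (names-sound (Tᵃ.τ z) e) of λ where
          (inj₁ e′)        → names-just e′
          (inj₂ (inj₁ e′)) → ⊥-elim (a≢b (inj E Da Db (trans (sym e′) πp)))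
          (inj₂ (inj₂ e′)) → ⊥-elim (true≢false e′ (trans (cong (free σ) πp) (occupied E Db)))
      roomᵇ : reserve + 2 * q ^ length ys ≤ count (free Tᵃ.τ)
      roomᵇ = +-cancelʳ-≤ (2 * q ^ length xs) _ _
        (≤-trans (≤-reflexive (+-assoc reserve _ _)) (≤-trans roomᵃ Tᵃ.room))
      Tᵇ : Tree Tᵃ.τ b (φ b) (y ∷ ys) (q ^ length ys)
      Tᵇ = growTree Tᵃ.τ b (φ b) y ys Tᵃ.fine (inV′ E Db)
        (occupied-⊑ {σ} {Tᵃ.τ} Tᵃ.σ⊑τ (occupied E Db)) loadᵇ roomᵇ
      module Tᵇ = Tree Tᵇ

    addConnectingPath : ∀ e {Dom φ σ} a mid b → Embedded Dom φ σ → Dom a ≡ true → Dom b ≡ true →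
                        All (λ x → Dom x ≡ false) mid → Unique (a ∷ mid ++ [ b ]) →
                        Linked (Adj H) (a ∷ mid ++ [ b ]) → length mid ≡ e + (suc c + suc c) →
                        Outcome Dom φ (a ∷ mid ++ [ b ])
    addConnectingPath (suc e) {Dom} a (z ∷ mid) b E Da Db (¬Dz ∷ out) (_ ∷ uq@(z∉ ∷ _)) (az ∷ l) len
      with leaf E Da ¬Dz az
    ... | y , σ′ , E′ , emb = prepend Da ¬Dz emb
      (addConnectingPath e z mid b E′ (insert-new Dom z) (insert-old Dom z Db)
        (outside-insert (All.++⁻ˡ mid z∉) out) uq l (suc-injective len))
    addConnectingPath zero {Dom} {φ} a mid b E Da Db out (a∉ ∷ uq) l len with split-ʳ++ (suc c) mid len
    ... | xs , ys , refl , lx , ly =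
      subst (Outcome Dom φ) (sym shape) (join xs ys E Da Db
        (λ { refl → All.lookup a∉ (∈-++⁺ʳ (xs ʳ++ ys) (here refl)) refl })
        (All-resp-↭ (↭-sym (++↭ʳ++ xs ys)) out)
        (unique-↭ (↭-sym (++↭ʳ++ xs ys)) (proj₁ (unique-++⁻ (xs ʳ++ ys) uq)))
        lx ly (subst (Linked (Adj H)) shape l))
      where
      shape : a ∷ (xs ʳ++ ys) ++ [ b ] ≡ (xs ++ [ a ]) ʳ++ (ys ++ [ b ])
      shape = trans (cong (a ∷_) (ʳ++-++ xs)) (sym (++-ʳ++ xs))

    addPath : ∀ {Dom φ σ} a mid b → Embedded Dom φ σ → Dom a ≡ true →
              All (λ x → Dom x ≡ false) mid → Unique (a ∷ mid ++ [ b ]) →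
              Linked (Adj H) (a ∷ mid ++ [ b ]) → suc c + suc c ≤ length mid →
              Outcome Dom φ (a ∷ mid ++ [ b ])
    addPath {Dom} a mid b E Da out uq l len with split (Dom b)
    ... | inj₁ Db  = addConnectingPath (length mid ∸ (suc c + suc c)) a mid b E Da Db out uq l (sym (m∸n+n≡m len))
    ... | inj₂ ¬Db with uq
    ... | _ ∷ uq′  = addPendantPath a (mid ++ [ b ]) E Da (All.++⁺ out (¬Db ∷ [])) uq′ l

  module _ {r : ℕ} {V0 : Fin m → Bool} {E0 : Graph m} {h : Fin r → Fin m}
           (Fo : RootedForest V0 E0 h) (E0⊆H : ∀ {u v} → Adj E0 u v → Adj H u v) where

    open RootedForest Fo

    record PartialForest (Dom : Fin m → Bool) (φ : Fin m → Fin n) (σ : Asg) : Set where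
      field
        embedded : Embedded Dom φ σ
        inForest : ∀ {x} → Dom x ≡ true → V0 x ≡ true
        hasRoots : ∀ i → Dom (h i) ≡ true
        rooted   : ∀ {x} → Dom x ≡ true → ∃ λ i → Star (Within E0 Dom) (h i) x
        edges    : ∀ {u v} → Dom u ≡ true → Dom v ≡ true → Adj E0 u v → Emb φ u v

    record WholeForest (φ₀ : Fin m → Fin n) : Set where
      field
        {Dom}    : Fin m → Bool
        {φ}      : Fin m → Fin n
        {σ}      : Asg
        embedded : Embedded Dom φ σ
        inForest : ∀ {x} → Dom x ≡ true → V0 x ≡ true
        all      : ∀ {x} → V0 x ≡ true → Dom x ≡ true
        edges    : ∀ {u v} → Adj E0 u v → Emb φ u v
        onRoots  : ∀ i → φ (h i) ≡ φ₀ (h i)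

    E0-sym : ∀ {u v} → Adj E0 u v → Adj E0 v u
    E0-sym {u} {v} e = trans (sym (proj₁ simple u v)) e

    addForestVertex : ∀ {Dom φ σ x z} → PartialForest Dom φ σ → Dom x ≡ true → Dom z ≡ false →
                      Adj E0 x z → ∃₂ λ y σ′ → PartialForest (insert Dom z) (upd φ z y) σ′
    addForestVertex {Dom} {φ} {σ} {x} {z} P Dx ¬Dz xz = finish (leaf P.embedded Dx ¬Dz (E0⊆H xz))
      where
      module P = PartialForest P
      Dom⁺ : Fin m → Bool
      Dom⁺ = insert Dom z
      weaken : ∀ {u v} → Within E0 Dom u v → Within E0 Dom⁺ u v
      weaken (e , Du , Dv) = e , insert-old Dom z Du , insert-old Dom z Dv
      only-x : ∀ {u} → Dom u ≡ true → Adj E0 u z → x ≡ u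
      only-x Du uz = forest-unique-parent Fo Dx Du ¬Dz xz uz (P.rooted Dx) (P.rooted Du)
      finish : (∃₂ λ y σ′ → Embedded Dom⁺ (upd φ z y) σ′ × Emb (upd φ z y) x z) →
               ∃₂ λ y σ′ → PartialForest Dom⁺ (upd φ z y) σ′
      finish (y , σ′ , E′ , emb) = y , σ′ , record
        { embedded = E′
        ; inForest = inForest′
        ; hasRoots = λ i → insert-old Dom z (P.hasRoots i)
        ; rooted   = rooted′
        ; edges    = edges′
        }
        where
        inForest′ : ∀ {u} → Dom⁺ u ≡ true → V0 u ≡ true
        inForest′ Du = case insert-inv Dom z Du of λ where
          (inj₁ refl) → proj₂ (edgesIn x z xz)
          (inj₂ Du′)  → P.inForest Du′
        rooted′ : ∀ {u} → Dom⁺ u ≡ true → ∃ λ i → Star (Within E0 Dom⁺) (h i) u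
        rooted′ Du = case insert-inv Dom z Du of λ where
          (inj₂ Du′)  → proj₁ (P.rooted Du′) , Star.map weaken (proj₂ (P.rooted Du′))
          (inj₁ refl) → proj₁ (P.rooted Dx) ,
            Star.map weaken (proj₂ (P.rooted Dx)) ◅◅ (xz , insert-old Dom z Dx , insert-new Dom z) ◅ ε
        edges′ : ∀ {u v} → Dom⁺ u ≡ true → Dom⁺ v ≡ true → Adj E0 u v → Emb (upd φ z y) u v
        edges′ {u} {v} Du Dv uv with insert-inv Dom z Du | insert-inv Dom z Dv
        ... | inj₁ refl | inj₁ refl = ⊥-elim (true≢false uv (proj₂ simple z))
        ... | inj₁ refl | inj₂ Dv′ with refl ← only-x Dv′ (E0-sym uv) = Emb-sym {upd φ z y} emb
        ... | inj₂ Du′  | inj₁ refl with refl ← only-x Du′ uv = emb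
        ... | inj₂ Du′  | inj₂ Dv′  =
          Emb-≡ (upd-agree φ y ¬Dz Du′) (upd-agree φ y ¬Dz Dv′) (P.edges Du′ Dv′ uv)

    growForest : ∀ f {Dom φ σ} → count (λ x → not (Dom x)) ≤ f → PartialForest Dom φ σ → WholeForest φ
    growForest f {Dom} {φ} ≤f P
      with F.any? (λ z → F.any? (λ x → (Dom z Bool.≟ false) ×-dec (Dom x Bool.≟ true) ×-dec (E0 x z Bool.≟ true)))
    ... | no none = record
      { embedded = P.embedded
      ; inForest = P.inForest
      ; all      = everywhere
      ; edges    = λ {u} {v} uv → let Vu , Vv = edgesIn u v uv in P.edges (everywhere Vu) (everywhere Vv) uv
      ; onRoots  = λ _ → refl
      }
      where
      module P = PartialForest P
      reach : ∀ {u v} → Dom u ≡ true → Star (Adj E0) u v → Dom v ≡ true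
      reach Du ε = Du
      reach {u} Du (_◅_ {j = w} uw s) = case split (Dom w) of λ where
        (inj₁ Dw)  → reach Dw s
        (inj₂ ¬Dw) → ⊥-elim (none (w , u , ¬Dw , Du , uw))
      everywhere : ∀ {x} → V0 x ≡ true → Dom x ≡ true
      everywhere {x} Vx = let i , s = covered x Vx in reach (P.hasRoots i) s
    growForest zero {Dom} ≤0 P | yes (z , x , ¬Dz , _) =
      ⊥-elim (<-irrefl refl (≤-trans (count≥1 {p = λ u → not (Dom u)} z (not-intro ¬Dz)) ≤0))
    growForest (suc f) {Dom} {φ} ≤f P | yes (z , x , ¬Dz , Dx , xz)
      with addForestVertex P Dx ¬Dz xz
    ... | y , σ′ , P′ = record
      { embedded = W.embedded ; inForest = W.inForest ; all = W.all ; edges = W.edges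
      ; onRoots  = λ i → trans (W.onRoots i) (upd-agree φ y ¬Dz (PartialForest.hasRoots P i)) }
      where
      fewer : count (λ u → not (insert Dom z u)) ≤ f
      fewer = ≤-pred (≤-trans (count-strict {p = λ u → not (insert Dom z u)} {q = λ u → not (Dom u)} z
        (λ u e → not-intro (¬-not λ Du → true≢false (insert-old Dom z Du) (not-elim e)))
        (cong not (insert-new Dom z)) (not-intro ¬Dz)) ≤f)
      module W = WholeForest (growForest f fewer P′)

    reverseOutcome : ∀ {Dom φ} p → Outcome Dom φ (reverse p) → Outcome Dom φ p
    reverseOutcome p O = record
      { embedded = O.embedded
      ; grows    = O.grows
      ; agree    = O.agree
      ; onlyIn   = λ D′x → case O.onlyIn D′x of λ where
          (inj₁ Dx) → inj₁ Dx
          (inj₂ x∈) → inj₂ (∈-resp-↭ (↭-reverse p) x∈)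
      ; allIn    = All-resp-↭ (↭-reverse p) O.allIn
      ; linked   = subst (Linked (Emb O.φ′)) (reverse-involutive p)
                     (linked-reverse (Emb-sym {O.φ′}) (reverse p) O.linked)
      }
      where module O = Outcome O

    module _ (c : ℕ) (s≤qᶜ : s ≤ q ^ c) (qᶜ≤qs : q ^ c ≤ q * s)
             (PC : PathConstructible H V0 E0 (2 * c + 3)) where

      open PathConstructible PC

      addAnchoredPath : ∀ {Dom φ σ} a mid b → Embedded Dom φ σ → Dom a ≡ true ⊎ Dom b ≡ true →
                        All (λ x → Dom x ≡ false) mid → Unique (a ∷ mid ++ [ b ]) →
                        Linked (Adj H) (a ∷ mid ++ [ b ]) → suc c + suc c ≤ length mid →
                        Outcome Dom φ (a ∷ mid ++ [ b ])
      addAnchoredPath a mid b E (inj₁ Da) out uq l len = addPath c s≤qᶜ qᶜ≤qs a mid b E Da out uq l len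
      addAnchoredPath {Dom} {φ} a mid b E (inj₂ Db) out uq l len =
        reverseOutcome (a ∷ mid ++ [ b ]) (subst (Outcome Dom φ) (sym reversed)
          (addPath c s≤qᶜ qᶜ≤qs b (reverse mid) a E Db (All-resp-↭ (↭-sym (↭-reverse mid)) out)
            (subst Unique reversed (unique-↭ (↭-sym (↭-reverse (a ∷ mid ++ [ b ]))) uq))
            (subst (Linked (Adj H)) reversed (linked-reverse Adj-sym (a ∷ mid ++ [ b ]) l))
            (≤-trans len (≤-reflexive (sym (length-reverse mid))))))
        where
        reversed : reverse (a ∷ mid ++ [ b ]) ≡ b ∷ reverse mid ++ [ a ]
        reversed = trans (unfold-reverse a (mid ++ [ b ])) (cong (_++ [ a ]) (reverse-++ mid [ b ]))

      record PathsUpTo (φ₀ : Fin m → Fin n) (i : ℕ) : Set where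
        field
          {Dom}    : Fin m → Bool
          {φ}      : Fin m → Fin n
          {σ}      : Asg
          embedded : Embedded Dom φ σ
          origin   : ∀ {x} → Dom x ≡ true → V0 x ≡ true ⊎ ∃ λ j → F.toℕ j < i × x ∈ P j
          forest   : ∀ {x} → V0 x ≡ true → Dom x ≡ true
          paths    : ∀ {j x} → F.toℕ j < i → x ∈ P j → Dom x ≡ true
          edges₀   : ∀ {u v} → Adj E0 u v → Emb φ u v
          edgesᴾ   : ∀ {j} → F.toℕ j < i → Linked (Emb φ) (P j)
          onRoots  : ∀ i → φ (h i) ≡ φ₀ (h i)

      extendPaths : ∀ {φ₀} j → (S : PathsUpTo φ₀ (F.toℕ j)) →
                    Outcome (PathsUpTo.Dom S) (PathsUpTo.φ S) (P j) → PathsUpTo φ₀ (suc (F.toℕ j))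
      extendPaths {φ₀} j S O = record
        { embedded = O.embedded
        ; origin   = λ D′x → case O.onlyIn D′x of λ where
            (inj₂ x∈) → inj₂ (j , ≤-refl , x∈)
            (inj₁ Dx) → case S.origin Dx of λ where
              (inj₁ V0x)            → inj₁ V0x
              (inj₂ (j′ , lt , x∈)) → inj₂ (j′ , m≤n⇒m≤1+n lt , x∈)
        ; forest   = λ V0x → O.grows (S.forest V0x)
        ; paths    = paths′
        ; edges₀   = λ {u} {v} uv → let Vu , Vv = edgesIn u v uv in
            Emb-≡ (O.agree (S.forest Vu)) (O.agree (S.forest Vv)) (S.edges₀ uv)
        ; edgesᴾ   = edges′
        ; onRoots  = λ i → trans (O.agree (S.forest (rootsIn i))) (S.onRoots i)
        }
        where
        module O = Outcome O
        module S = PathsUpTo S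
        paths′ : ∀ {j′ x} → F.toℕ j′ < suc (F.toℕ j) → x ∈ P j′ → O.Dom′ x ≡ true
        paths′ lt x∈ with m≤n⇒m<n∨m≡n (≤-pred lt)
        ... | inj₁ lt′ = O.grows (S.paths lt′ x∈)
        ... | inj₂ e with refl ← F.toℕ-injective e = All.lookup O.allIn x∈
        edges′ : ∀ {j′} → F.toℕ j′ < suc (F.toℕ j) → Linked (Emb O.φ′) (P j′)
        edges′ lt with m≤n⇒m<n∨m≡n (≤-pred lt)
        ... | inj₁ lt′ = linked-map (λ Du Dv → Emb-≡ (O.agree Du) (O.agree Dv))
                           (All.tabulate (S.paths lt′)) (S.edgesᴾ lt′)
        ... | inj₂ e with refl ← F.toℕ-injective e = O.linked

      nextPath : ∀ {φ₀} j → (S : PathsUpTo φ₀ (F.toℕ j)) →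
                 Outcome (PathsUpTo.Dom S) (PathsUpTo.φ S) (P j)
      nextPath j S with ends (P j) (≤-trans (≤-trans (s≤s (s≤s z≤n)) (m≤n+m 4 (2 * c))) long′)
        where
        long′ : 2 * c + 4 ≤ length (P j)
        long′ = ≤-trans (≤-reflexive (sym (+-assoc (2 * c) 3 1))) (long j)
      ... | a , mid , b , Pj≡ = subst (Outcome S.Dom S.φ) (sym Pj≡)
        (addAnchoredPath a mid b S.embedded anchor (All.tabulate outside)
          (subst Unique Pj≡ (isPath j))
          (subst (Linked (Adj H)) Pj≡ (edges⇒linked (P j) λ u v e → proj₂ (edges u v) (inj₂ (j , e))))
          enough)
        where
        module S = PathsUpTo S
        anchor : S.Dom a ≡ true ⊎ S.Dom b ≡ true
        anchor with anchored j
        ... | x , end , old = [ (λ { refl → inj₁ Dx }) , (λ { refl → inj₂ Dx }) ]′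
                                (endpoint-cases mid (subst (λ p → Endpoint p x) Pj≡ end))
          where
          Dx : S.Dom x ≡ true
          Dx = case old of λ where
            (inj₁ V0x)            → S.forest V0x
            (inj₂ (j′ , lt , x∈)) → S.paths lt x∈
        outside : ∀ {x} → x ∈ mid → S.Dom x ≡ false
        outside {x} x∈ with ∈-∃++ x∈
        ... | ys , zs , refl = ¬-not λ Dx → case S.origin Dx of λ where
            (inj₁ V0x)            → true≢false V0x (proj₁ fresh)
            (inj₂ (j′ , lt , x∈′)) → proj₂ fresh j′ lt x∈′
          where
          fresh : (V0 x ≡ false) × (∀ j′ → j′ <ᶠ j → x ∉ P j′)
          fresh = internal j x (a , b , ys , zs , trans Pj≡ (cong (a ∷_) (++-assoc ys (x ∷ zs) [ b ])))
        enough : suc c + suc c ≤ length mid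
        enough = +-cancelʳ-≤ 2 _ _ (begin
          suc c + suc c + 2             ≡⟨ solve 1 (λ c → (con 1 :+ c) :+ (con 1 :+ c) :+ con 2 := con 2 :* c :+ con 3 :+ con 1) refl c ⟩
          2 * c + 3 + 1                 ≤⟨ long j ⟩
          length (P j)                  ≡⟨ cong length Pj≡ ⟩
          suc (length (mid ++ [ b ]))   ≡⟨ cong suc (length-++ mid) ⟩
          suc (length mid + 1)          ≡⟨ sym (+-suc (length mid) 1) ⟩
          length mid + 2                ∎)
          where
          open ≤-Reasoning
          open +-*-Solver

      addPaths : ∀ {φ₀} → PathsUpTo φ₀ 0 → ∀ i → i ≤ k → PathsUpTo φ₀ i
      addPaths S₀ zero    _   = S₀
      addPaths {φ₀} S₀ (suc i) i<k = subst (λ l → PathsUpTo φ₀ (suc l)) toℕ≡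
          (extendPaths (F.fromℕ< i<k) S (nextPath (F.fromℕ< i<k) S))
        where
        toℕ≡ : F.toℕ (F.fromℕ< i<k) ≡ i
        toℕ≡ = F.toℕ-fromℕ< i<k
        S : PathsUpTo φ₀ (F.toℕ (F.fromℕ< i<k))
        S = subst (PathsUpTo φ₀) (sym toℕ≡) (addPaths S₀ i (<⇒≤ i<k))

      embedAll : ∀ {Dom φ σ} → PartialForest Dom φ σ →
                 ∃₂ λ φ′ σ′ → Embedded (λ _ → true) φ′ σ′ ×
                   (∀ u v → Adj H u v → Emb φ′ u v) × (∀ i → φ′ (h i) ≡ φ (h i))
      embedAll {Dom} {φ} P₀ = S.φ , S.σ , everywhere , emb , S.onRoots
        where
        module W = WholeForest (growForest (count (λ x → not (Dom x))) ≤-refl P₀)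
        S : PathsUpTo φ k
        S = addPaths record
          { embedded = W.embedded ; origin = λ Dx → inj₁ (W.inForest Dx) ; forest = W.all
          ; paths = λ () ; edges₀ = W.edges ; edgesᴾ = λ () ; onRoots = W.onRoots } k ≤-refl
        module S = PathsUpTo S
        total : ∀ x → S.Dom x ≡ true
        total x = case vertices x of λ where
          (inj₁ V0x)      → S.forest V0x
          (inj₂ (j , x∈)) → S.paths (F.toℕ<n j) x∈
        everywhere : Embedded (λ _ → true) S.φ S.σ
        everywhere = record
          { fine     = fine S.embedded
          ; inj      = λ {x} {y} _ _ → inj S.embedded (total x) (total y)
          ; inV′     = λ {x} _ → inV′ S.embedded (total x)
          ; occupied = λ {x} _ → occupied S.embedded (total x)
          ; onto     = λ y Vy fy → let x , _ , φx = onto S.embedded y Vy fy in x , refl , φx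
          ; served   = λ y p e → let x , z , _ , rest = served S.embedded y p e in x , z , (refl , refl) , rest
          }
        emb : ∀ u v → Adj H u v → Emb S.φ u v
        emb u v uv = case proj₁ (edges u v) uv of λ where
          (inj₁ e)       → S.edges₀ e
          (inj₂ (j , e)) → linked⇒edges (Emb-sym {S.φ}) (S.edgesᴾ (F.toℕ<n j)) u v e

  load≤degPre : ∀ {φ σ} → Embedded (λ _ → true) φ σ → ∀ v i → load σ (pair v i) ≤ degPre H col φ i v
  load≤degPre {φ} {σ} E v i with F.any? (λ x → φ x F.≟ v)
  ... | yes (x , refl) = begin
      load σ (pair (φ x) i)
        ≤⟨ count-image {p = λ y → names (σ y) (pair (φ x) i)} {q = λ z → H x z ∧ (col x z == i)} φ image ⟩
      degC H col i x
        ≡⟨ cong (λ b → if b then degC H col i x else 0) (sym (==-refl (φ x))) ⟩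
      (if φ x == φ x then degC H col i x else 0)
        ≤⟨ term≤sumF (λ z → if φ z == φ x then degC H col i z else 0) x ⟩
      degPre H col φ i (φ x) ∎
    where
    open ≤-Reasoning
    image : ∀ y → names (σ y) (pair (φ x) i) ≡ true → ∃ λ z → H x z ∧ (col x z == i) ≡ true × φ z ≡ y
    image y e =
      let x′ , z , _ , φz , eq , x′z = served E y (pair (φ x) i) (names-sound (σ y) e)
          φx≡ , i≡ = pair-injective (φ x) i (φ x′) (col x′ z) eq
          x≡x′ = inj E refl refl φx≡
      in z , subst (λ u → H u z ∧ (col u z == i) ≡ true) (sym x≡x′) (∧-intro x′z (==-complete (sym i≡))) , φz
  ... | no none = ≤-trans (≤-reflexive (count-none {p = λ y → names (σ y) (pair v i)} λ y → ¬-not λ e →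
      let x , z , _ , φz , eq , _ = served E y (pair v i) (names-sound (σ y) e)
      in none (x , sym (proj₁ (pair-injective v i (φ x) (col x z) eq))))) z≤n

-- The theorem

emptyRooting : ∀ {m} (H : Graph m) → Rooted H
emptyRooting H = record
  { isRoot = λ _ → true ; pathMid = λ _ → [] ; pathEnd = λ x → x ; pathOK = λ _ () ; pathUnq = λ _ () }

pCap-emptyRooting : ∀ {n m t} (H : Graph m) (col : Fin m → Fin m → Fin t) (φ : Fin m → Fin n) (X : Sub2 n t) →
                    pCap (emptyRooting H) col φ X ≡ 0
pCap-emptyRooting {n} {m} {t} H col φ X = trans
  (sumF-cong λ v → count-none {p = λ i → X v i ∧ anyF {m} (λ _ → false)} λ i → ¬-not λ e →
    case anyF-elim {m} (proj₂ (∧-elim {X v i} e)) of λ ())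
  (sumF-zero {n})

flatten : ∀ {n t} → Sub2 n t → Fin (n * t) → Bool
flatten {n} {t} X p = X (F.quotient t p) (F.remainder {n} t p)

flatten-combine : ∀ {n t} (X : Sub2 n t) v i → flatten X (F.combine v i) ≡ X v i
flatten-combine X v i = cong (λ (u , j) → X u j) (F.remQuot-combine v i)

count-flatten : ∀ {n t} (X : Sub2 n t) → count (flatten X) ≡ card2 X
count-flatten {n} {t} X = trans (sumF-combine n t (𝟙 ∘ flatten X))
  (sumF-cong λ v → count-cong λ i → flatten-combine X v i)

module Conclusion {n t m r : ℕ} (q s : ℕ) (2≤q : 2 ≤ q) (1≤s : 1 ≤ s)
  (G : Family n t) (G-simple : ∀ i → IsSimple (G i)) (joined : SJoined s G)
  (V′ U : Fin n → Bool) (largeV′ : n ≤ count V′ + s) (m≤n : m + 6 * s * suc q ≤ n)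
  (expand : ∀ X → (∀ p → X p ≡ true → V′ (F.quotient t p) ≡ true) → count X ≤ 2 * s →
    suc q * count X ≤ count (λ y → (U y ∧ V′ y) ∧ anyF (λ p → X p ∧ edgesOf G p y)))
  (H : Graph m) (H-simple : IsSimple H)
  (col : Fin m → Fin m → Fin t) (col-sym : IsColouring H col) (degree : MonDegLe H col (suc q))
  (V0 : Fin m → Bool) (E0 : Graph m) (h : Fin (suc r) → Fin m) (Fo : RootedForest V0 E0 h)
  (v : Fin (suc r) → Fin n) (v-inj : Injective _≡_ _≡_ v) (v∈ : ∀ i → V′ (v i) ∧ not (U (v i)) ≡ true)
  where

  isTarget : Fin n → Bool
  isTarget y = anyF (λ i → v i == y)

  A : Fin n → Bool
  A y = V′ y ∧ not (isTarget y)

  open Embedding {n * t} {n} {t} {m} q s 2≤q 1≤s G G-simple (F.quotient t) F.combine (edgesOf G)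
    quotient-combine F.combine-injective (edgesOf-combine G) (joined-edgesOf G joined)
    V′ A (λ y e → proj₁ (∧-elim {V′ y} e)) largeV′ m≤n H H-simple col col-sym degree public

  isRootVertex : Fin m → Bool
  isRootVertex x = anyF (λ i → h i == x)

  rootMap : Fin m → Fin n
  rootMap x with F.any? (λ i → h i F.≟ x)
  ... | yes (i , _) = v i
  ... | no  _       = v fzero

  h-inj : ∀ {i j} → h i ≡ h j → i ≡ j
  h-inj {i} {j} e = RootedForest.rootsSep Fo i j (subst (Star (Adj E0) (h i)) e ε)

  rootMap-h : ∀ i → rootMap (h i) ≡ v i
  rootMap-h i with F.any? (λ j → h j F.≟ h i)
  ... | yes (j , e) = cong v (h-inj e)
  ... | no none     = ⊥-elim (none (i , refl))

  root-inv : ∀ {x} → isRootVertex x ≡ true → ∃ λ i → x ≡ h i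
  root-inv {x} e with anyF-elim {p = λ i → h i == x} e
  ... | i , e′ = i , sym (==-sound e′)

  root-intro : ∀ i → isRootVertex (h i) ≡ true
  root-intro i = anyF-intro {p = λ j → h j == h i} i (==-refl (h i))

  target-intro : ∀ i → isTarget (v i) ≡ true
  target-intro i = anyF-intro {p = λ j → v j == v i} i (==-refl (v i))

  unassigned : Asg
  unassigned _ = nothing

  expands₀ : Expands unassigned
  expands₀ X X⊆ X≤ = ≤-trans (expand X X⊆ X≤)
    (count-mono {p = λ y → (U y ∧ V′ y) ∧ anyF (λ p → X p ∧ edgesOf G p y)} {q = hit unassigned X} λ y e →
      let UV , nb = ∧-elim {U y ∧ V′ y} e
          Uy , Vy = ∧-elim {U y} UV
          p , e′  = anyF-elim {p = λ p → X p ∧ edgesOf G p y} nb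
          Xp , py = ∧-elim {X p} e′
      in hit-intro unassigned X p Xp (∧-intro (∧-intro Vy (not-intro (¬-not (notTarget Uy)))) py))
    where
    notTarget : ∀ {y} → U y ≡ true → isTarget y ≡ true → ⊥
    notTarget {y} Uy e with anyF-elim {p = λ i → v i == y} e
    ... | i , e′ with refl ← ==-sound {x = v i} e′ =
      true≢false Uy (not-elim (proj₂ (∧-elim {V′ (v i)} (v∈ i))))

  embedded₀ : Embedded isRootVertex rootMap unassigned
  embedded₀ = record
    { fine     = record { expands = expands₀ ; valid = λ _ _ () ; closed = λ () }
    ; inj      = inj₀
    ; inV′     = λ Rx → case root-inv Rx of λ where
        (i , refl) → trans (cong V′ (rootMap-h i)) (proj₁ (∧-elim {V′ (v i)} (v∈ i)))
    ; occupied = λ Rx → case root-inv Rx of λ where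
        (i , refl) → ¬-not λ e → true≢false (target-intro i)
          (not-elim (proj₂ (∧-elim {V′ (v i)} (proj₁ (∧-elim {A (v i)}
            (trans (sym (cong (free unassigned) (rootMap-h i))) e))))))
    ; onto     = onto₀
    ; served   = λ _ _ ()
    }
    where
    inj₀ : ∀ {x y} → isRootVertex x ≡ true → isRootVertex y ≡ true → rootMap x ≡ rootMap y → x ≡ y
    inj₀ Rx Ry e with root-inv Rx | root-inv Ry
    ... | i , refl | j , refl = cong h (v-inj (trans (sym (rootMap-h i)) (trans e (rootMap-h j))))
    onto₀ : ∀ y → V′ y ≡ true → free unassigned y ≡ false → ∃ λ x → isRootVertex x ≡ true × rootMap x ≡ y
    onto₀ y Vy occ with split (isTarget y)
    ... | inj₂ e = ⊥-elim (true≢false (∧-intro {A y} (∧-intro Vy (not-intro e)) refl) occ)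
    ... | inj₁ e with anyF-elim {p = λ i → v i == y} e
    ... | i , e′ = h i , root-intro i , trans (rootMap-h i) (==-sound e′)

  root∈V0 : ∀ {x} → isRootVertex x ≡ true → V0 x ≡ true
  root∈V0 Rx with root-inv Rx
  ... | i , refl = RootedForest.rootsIn Fo i

  rootForest : (E0⊆H : ∀ {u v} → Adj E0 u v → Adj H u v) →
               PartialForest Fo E0⊆H isRootVertex rootMap unassigned
  rootForest E0⊆H = record
    { embedded = embedded₀
    ; inForest = root∈V0
    ; hasRoots = root-intro
    ; rooted   = λ Rx → case root-inv Rx of λ where (i , refl) → i , ε
    ; edges    = no-edges
    }
    where
    no-edges : ∀ {x y} → isRootVertex x ≡ true → isRootVertex y ≡ true → Adj E0 x y → Emb rootMap x y
    no-edges Rx Ry xy with root-inv Rx | root-inv Ry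
    ... | i , refl | j , refl with RootedForest.rootsSep Fo i j (xy ◅ ε)
    ... | refl = ⊥-elim (true≢false xy (proj₂ (RootedForest.simple Fo) (h i)))

  embedded⇒good : ∀ {φ σ} → Embedded (λ _ → true) φ σ → Good G V′ H (emptyRooting H) col (2 * s) (suc q) φ
  embedded⇒good {φ} {σ} E X X⊆V′ X≤ = begin
    suc q * card2 X + pCap (emptyRooting H) col φ X
      ≡⟨ cong₂ (λ a b → suc q * a + b) (sym (count-flatten X)) (pCap-emptyRooting H col φ X) ⟩
    suc q * count (flatten X) + 0
      ≡⟨ +-identityʳ _ ⟩
    suc q * count (flatten X)
      ≤⟨ Fine.expands (Embedded.fine E) (flatten X) (λ p → X⊆V′ _ _)
           (≤-trans (≤-reflexive (count-flatten X)) X≤) ⟩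
    cov σ (flatten X)
      ≤⟨ cov-split σ (flatten X) ⟩
    count freeNbr + sumF (λ p → if flatten X p then load σ p else 0)
      ≤⟨ +-mono-≤ free≤ load≤ ⟩
    gammaOut G V′ φ X + sumF (λ w → sumF (λ i → if X w i then degPre H col φ i w else 0)) ∎
    where
    open ≤-Reasoning
    freeNbr : Fin n → Bool
    freeNbr y = free σ y ∧ anyF (λ p → flatten X p ∧ edgesOf G p y)
    free≤ : count freeNbr ≤ gammaOut G V′ φ X
    free≤ = count-mono {p = freeNbr} λ y e →
      let fy , nb = ∧-elim {free σ y} e
          Ay , _  = ∧-elim {A y} fy
          Vy , _  = ∧-elim {V′ y} Ay
          p , Xp  = anyF-elim {p = λ p → flatten X p ∧ edgesOf G p y} nb
      in ∧-intro Vy (∧-intro (not-intro (¬-not (outside fy)))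
           (anyF-intro {p = λ w → anyF (λ i → X w i ∧ G i w y)} (F.quotient t p)
             (anyF-intro {p = λ i → X (F.quotient t p) i ∧ G i (F.quotient t p) y} (F.remainder {n} t p) Xp)))
      where
      outside : ∀ {y} → free σ y ≡ true → inImage φ y ≡ true → ⊥
      outside {y} fy e with anyF-elim {p = λ x → φ x == y} e
      ... | x , e′ with refl ← ==-sound {x = φ x} e′ = true≢false fy (Embedded.occupied E {x} refl)
    load≤ : sumF (λ p → if flatten X p then load σ p else 0) ≤
            sumF (λ w → sumF (λ i → if X w i then degPre H col φ i w else 0))
    load≤ = ≤-trans (≤-reflexive (sumF-combine n t _)) (sumF-mono λ w → sumF-mono (pointwise w))
      where
      pointwise : ∀ w i → (if flatten X (F.combine w i) then load σ (F.combine w i) else 0) ≤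
                          (if X w i then degPre H col φ i w else 0)
      pointwise w i rewrite flatten-combine X w i with X w i
      ... | true  = load≤degPre E w i
      ... | false = z≤n

theorem3p4 : (r s t D n m : ℕ) → 1 ≤ r → 1 ≤ s → 1 ≤ t → 3 ≤ D →
    (G : Family n t) → (∀ i → IsSimple (G i)) → SJoined s G →
    (V0 : Fin m → Bool) (E0 : Graph m) (h : Fin r → Fin m) →
    RootedForest V0 E0 h →
    (H : Graph m) → IsSimple H →
    (c : ℕ) → IsCeilLog (D ∸ 1) s c →
    PathConstructible H V0 E0 (2 * c + 3) →
    m + 6 * s * D ≤ n →
    (col : Fin m → Fin m → Fin t) → IsColouring H col → MonDegLe H col D →
    Σ (Fin n → Bool) λ W → Σ (Fin n → Bool) λ V' →
    (∀ v → W v ≡ true → V' v ≡ true) ×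
    (n ≤ count V' + s) ×
    (n ≤ count W + 3 * s * D + 5 * s) ×
    ((v : Fin r → Fin n) → Injective _≡_ _≡_ v → (∀ i → W (v i) ≡ true) →
    Σ (Rooted H) λ Rt → (∀ i → Rooted.isRoot Rt (h i) ≡ true) ×
    Σ (Fin m → Fin n) λ φ → IsEmbedding G V' H col φ ×
    Good G V' H Rt col (2 * s) D φ × (∀ i → φ (h i) ≡ v i))
theorem3p4 (suc r) s t (suc q) n m _ 1≤s _ (s≤s 2≤q) G G-simple joined V0 E0 h Fo H H-simple
           c (s≤qᶜ , least) PC m≤n col col-sym degree =
  W , V′ , (λ v e → proj₁ (∧-elim {V′ v} e)) , largeV′ , largeW , embed
  where
  size : ℕ
  size = 3 * s * suc q + 4 * s
  U : Fin n → Bool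
  U y = ⌊ F.toℕ y <? size ⌋
  size≤n : size ≤ n
  size≤n = ≤-trans (+-monoʳ-≤ (3 * s * suc q) (≤-trans (*-monoˡ-≤ s (m≤m+n 4 5))
      (≤-trans (≤-reflexive (solve 1 (λ s → con 9 :* s := con 3 :* s :* con 3) refl s))
        (*-monoʳ-≤ (3 * s) (s≤s 2≤q)))))
    (≤-trans (≤-reflexive (solve 2 (λ s D → con 3 :* s :* D :+ con 3 :* s :* D := con 6 :* s :* D) refl s (suc q)))
      (≤-trans (m≤n+m _ m) m≤n))
    where open +-*-Solver
  open Pruning (suc q) s (edgesOf G) (F.quotient t) (joined-edgesOf G joined) U (count-initial size size≤n)
  pruned : ∃ Pruned
  pruned = prune 1≤s
  V′ : Fin n → Bool
  V′ = proj₁ pruned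
  W : Fin n → Bool
  W y = V′ y ∧ not (U y)
  largeV′ : n ≤ count V′ + s
  largeV′ = proj₁ (proj₂ pruned)
  largeW : n ≤ count W + 3 * s * suc q + 5 * s
  largeW = begin
    n                              ≤⟨ largeV′ ⟩
    count V′ + s                   ≤⟨ +-monoˡ-≤ s (count-cover {p = V′} {q = W} {r = U} λ y Vy →
                                        case split (U y) of λ where
                                          (inj₁ Uy) → inj₂ Uy
                                          (inj₂ Uy) → inj₁ (∧-intro Vy (not-intro Uy))) ⟩
    count W + count U + s          ≤⟨ +-monoˡ-≤ s (+-monoʳ-≤ (count W) (count-initial-≤ {n} size)) ⟩
    count W + size + s             ≡⟨ solve 3 (λ w s D → w :+ (con 3 :* s :* D :+ con 4 :* s) :+ s :=
                                        w :+ con 3 :* s :* D :+ con 5 :* s) refl (count W) s (suc q) ⟩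
    count W + 3 * s * suc q + 5 * s ∎
    where
    open ≤-Reasoning
    open +-*-Solver
  power-bound : ∀ k → (∀ j → s ≤ q ^ j → k ≤ j) → q ^ k ≤ q * s
  power-bound zero    _     = *-mono-≤ (≤-trans (s≤s z≤n) 2≤q) 1≤s
  power-bound (suc k) least = *-monoʳ-≤ q (<⇒≤ (≰⇒> λ s≤qᵏ → <-irrefl refl (least k s≤qᵏ)))
  E0⊆H : ∀ {u v} → Adj E0 u v → Adj H u v
  E0⊆H {u} {v} e = proj₂ (PathConstructible.edges PC u v) (inj₁ e)
  embed : (v : Fin (suc r) → Fin n) → Injective _≡_ _≡_ v → (∀ i → W (v i) ≡ true) →
    Σ (Rooted H) λ Rt → (∀ i → Rooted.isRoot Rt (h i) ≡ true) ×
    Σ (Fin m → Fin n) λ φ → IsEmbedding G V′ H col φ ×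
    Good G V′ H Rt col (2 * s) (suc q) φ × (∀ i → φ (h i) ≡ v i)
  embed v v-inj v∈ = finish (embedAll Fo E0⊆H c s≤qᶜ (power-bound c least) PC (rootForest E0⊆H))
    where
    open Conclusion q s 2≤q 1≤s G G-simple joined V′ U largeV′ m≤n (proj₂ (proj₂ pruned))
           H H-simple col col-sym degree V0 E0 h Fo v v-inj v∈
    finish : (∃₂ λ φ σ → Embedded (λ _ → true) φ σ × (∀ u w → Adj H u w → Emb φ u w) ×
                (∀ i → φ (h i) ≡ rootMap (h i))) →
      Σ (Rooted H) λ Rt → (∀ i → Rooted.isRoot Rt (h i) ≡ true) ×
      Σ (Fin m → Fin n) λ φ → IsEmbedding G V′ H col φ ×
      Good G V′ H Rt col (2 * s) (suc q) φ × (∀ i → φ (h i) ≡ v i)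
    finish (φ , σ , E , emb , onRoots) =
      emptyRooting H , (λ _ → refl) , φ ,
      ((λ {x} {y} → Embedded.inj E {x} {y} refl refl) , (λ x → Embedded.inV′ E {x} refl) ,
       λ u w uw → proj₂ (emb u w uw)) ,
      embedded⇒good E , λ i → trans (onRoots i) (rootMap-h i)
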